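{- Let $R$ be a $(\neg\mathsf{w}\otimes)$-proof-structure. If $R\models\mathsf{ACC}_{\sharp\mathsf w}$, then $R$ is sequential.
   Context: Graphs are finite directed graphs (parallel arcs allowed, no loops). An arc is a conclusion of its tail and a premise of its head. $\wp$ denotes the "par" connective. A linear logical graph is such a graph without directed cycles, each node labelled by one of $\mathtt{ax},\mathtt{cut},\mathtt 1,\bot,\otimes,\wp,\bullet$, where: an $\mathtt{ax}$ node has exactly 2 conclusions and no premise; a $\mathtt{cut}$ node exactly 2 premises and no conclusion; a $\mathtt 1$ or $\bot$ node exactly 1 conclusion and no premise; a $\otimes$ node exactly 2 premises and 1 conclusion; a $\wp$ node 1 or 2 premises and 1 conclusion; a $\bullet$ node exactly 1 premise and no conclusion. A conclusion of the graph is a premise of a $\bullet$ node. A proof-structure (ps) is a linear logical graph in which every $\wp$ node has two premises, with an ordering (left, right) of the premises of each $\otimes$ and $\wp$ node and a total ordering of its conclusions. (No types are required; $\mathtt{cut}$ nodes are allowed.) A switching $\varphi$ of a ps $R$ maps each $\wp$ node to one of its premises. The switching graph $R^\varphi$ is obtained by adding, for each $\wp$ node $n$, a fresh $\bullet$ node and redirecting to it the head of the premise of $n$ different from $\varphi(n)$. $R\models\mathsf{ACC}_{\sharp\mathsf w}$ means: for every switching $\varphi$, $R^\varphi$ has no (undirected) cycle and its number of connected components equals (number of $\bot$ nodes of $R$) $+1$. Erasing nodes (inductive definition): a node is erasing when it is a $\bot$, $\wp$ or $\bullet$ node all of whose premises are conclusions of erasing nodes (in particular every $\bot$ node is erasing).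 A $(\neg\mathsf w\otimes)$-proof-structure is a ps in which no premise of a $\mathtt{cut}$ or $\otimes$ node is the conclusion of an erasing node. Sequential ps (by induction on the number of arcs; the order of the conclusions of the ps involved plays no role): $R$ is sequential if it is $n$-sequential for some node $n$, where $R$ is $n$-sequential if one of the following holds. (1) $n$ is an $\mathtt{ax}$ or $\mathtt 1$ node and $R$ consists of $n$, its conclusion(s), and the $\bullet$ node(s) these point to. (2) $n$ is a $\bot$ node and $R$ is the disjoint union of a sequential ps $R_1$ with $n$, its conclusion and the $\bullet$ node it points to. (3) $n$ is a $\wp$ node and $R$ is obtained from a sequential ps $R_1$ by choosing two distinct conclusions of $R_1$, deleting their $\bullet$ nodes, making them the left and right premises of $n$, and letting the conclusion of $n$ point to a new $\bullet$ node. (4) $n$ is a $\otimes$ node and $R$ is obtained from the disjoint union of two sequential ps $R_1,R_2$ by choosing a conclusion of $R_1$ and a conclusion of $R_2$, deleting their $\bullet$ nodes, making them the left and right premise of $n$, and letting the conclusion of $n$ point to a new $\bullet$ node. (5) $n$ is a $\mathtt{cut}$ node and $R$ is obtained as in (4), except that $n$ has no conclusion. -}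

module Defs where

open import Data.Fin using (Fin; _≟_)
open import Data.List using (List; []; _∷_; length; filter; allFin; map)
open import Data.List.Membership.Propositional using (_∈_; _∉_)
open import Data.List.Relation.Unary.Unique.Propositional using (Unique)
open import Data.Nat using (ℕ; suc)
open import Data.Product using (Σ-syntax; ∃; ∃-syntax; _×_; _,_)
open import Data.Sum using (_⊎_; inj₁; inj₂; [_,_]) renaming (map to map-⊎)
open import Data.Unit using (⊤; tt)
open import Function.Base using (_∘_)
open import Function.Bundles using (_↔_; _⇔_; Inverse)
open import Function.Definitions using (Surjective)
open import Relation.Binary.Construct.Closure.Equivalence using (EqClosure)
open import Relation.Binary.Construct.Closure.ReflexiveTransitive using (ε; _◅_)
open import Relation.Binary.Construct.Closure.Symmetric using (SymClosure; fwd; bwd)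
open import Relation.Binary.Construct.Closure.Transitive using (TransClosure)
open import Relation.Binary.PropositionalEquality using (_≡_; _≢_; refl)
open import Relation.Nullary using (¬_; Dec; yes; no)

-- Directed multigraphs.  Finiteness comes with `FiniteLabelledGraph`, and the
-- acyclicity condition of `LinearLogicalGraph` excludes loops.

record Graph : Set₁ where
  field
    Node Arc  : Set
    tail head : Arc → Node

  Link : Node → Node → Set
  Link x y = ∃[ a ] tail a ≡ x × head a ≡ y

  HasDirectedCycle : Set
  HasDirectedCycle = ∃[ x ] TransClosure Link x x

  -- An inhabitant is an undirected walk.
  Connected : Node → Node → Set
  Connected = EqClosure Link

  arcOf : ∀ {x y} → SymClosure Link x y → Arc
  arcOf (fwd (a , _)) = a
  arcOf (bwd (a , _)) = a

  arcsOf : ∀ {x y} → Connected x y → List Arc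
  arcsOf ε       = []
  arcsOf (s ◅ w) = arcOf s ∷ arcsOf w

  -- The nodes of a walk, except its endpoint.
  nodesOf : ∀ {x y} → Connected x y → List Node
  nodesOf ε           = []
  nodesOf {x} (_ ◅ w) = x ∷ nodesOf w

  -- Distinctness of the arcs excludes going back and forth along one arc,
  -- while two parallel arcs do form a cycle.
  record Cycle : Set where
    field
      {start}        : Node
      walk           : Connected start start
      nonEmpty       : arcsOf walk ≢ []
      distinct-arcs  : Unique (arcsOf walk)
      distinct-nodes : Unique (nodesOf walk)

  record NumberOfComponents (k : ℕ) : Set where
    field
      component  : Node → Fin k
      surjective : Surjective _≡_ _≡_ component
      correct    : ∀ x y → component x ≡ component y ⇔ Connected x y

data Label : Set where
  ax cut one bot ⊗ ⅋ • : Label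

-- `Arity l p c`: a node labelled l may have p premises and c conclusions.
data Arity : Label → ℕ → ℕ → Set where
  ax-arity  : Arity ax  0 2
  cut-arity : Arity cut 2 0
  one-arity : Arity one 0 1
  bot-arity : Arity bot 0 1
  ⊗-arity   : Arity ⊗   2 1
  ⅋-arity₁  : Arity ⅋   1 1
  ⅋-arity₂  : Arity ⅋   2 1
  •-arity   : Arity •   1 0

-- The labels whose nodes have ordered premises.
data Ordered : Label → Set where
  ⊗-ordered : Ordered ⊗
  ⅋-ordered : Ordered ⅋

bot? : (l : Label) → Dec (l ≡ bot)
bot? ax  = no λ ()
bot? cut = no λ ()
bot? one = no λ ()
bot? bot = yes refl
bot? ⊗   = no λ ()
bot? ⅋   = no λ ()
bot? •   = no λ ()

⅋? : (l : Label) → Dec (l ≡ ⅋)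
⅋? ax  = no λ ()
⅋? cut = no λ ()
⅋? one = no λ ()
⅋? bot = no λ ()
⅋? ⊗   = no λ ()
⅋? ⅋   = yes refl
⅋? •   = no λ ()

record FiniteLabelledGraph : Set where
  field
    #nodes #arcs : ℕ
    src tgt      : Fin #arcs → Fin #nodes
    label        : Fin #nodes → Label

  graph : Graph
  graph = record { Node = Fin #nodes ; Arc = Fin #arcs ; tail = src ; head = tgt }

  open Graph graph public

  premises conclusions : Node → List Arc
  premises    n = filter (λ a → head a ≟ n) (allFin #arcs)
  conclusions n = filter (λ a → tail a ≟ n) (allFin #arcs)

  #bot : ℕ
  #bot = length (filter (λ n → bot? (label n)) (allFin #nodes))

record LinearLogicalGraph : Set where
  field
    labelledGraph : FiniteLabelledGraph

  open FiniteLabelledGraph labelledGraph public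

  field
    arity   : ∀ n → Arity (label n) (length (premises n)) (length (conclusions n))
    acyclic : ¬ HasDirectedCycle

record ProofStructure : Set where
  field
    linearLogicalGraph : LinearLogicalGraph

  open LinearLogicalGraph linearLogicalGraph public

  field
    ⅋-premises : ∀ n → label n ≡ ⅋ → length (premises n) ≡ 2

    left right : ∀ n → Ordered (label n) → Arc
    head-left  : ∀ n o → head (left n o) ≡ n
    head-right : ∀ n o → head (right n o) ≡ n
    left≢right : ∀ n o → left n o ≢ right n o

    -- The conclusions of the graph, listed in order.
    conclusionList     : List Arc
    conclusionUnique   : Unique conclusionList
    conclusionComplete : ∀ a → a ∈ conclusionList ⇔ label (head a) ≡ •

module _ (R : ProofStructure) where
  open ProofStructure R

  record Switching : Set where
    field
      choice         : ∀ n → label n ≡ ⅋ → Arc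
      choice-premise : ∀ n p → head (choice n p) ≡ n

  -- The fresh node added for a ⅋ node n labelled by p is `inj₂ (n , p)`.
  switchingGraph : Switching → Graph
  switchingGraph φ = record
    { Node = Node ⊎ (∃[ n ] label n ≡ ⅋)
    ; Arc  = Arc
    ; tail = inj₁ ∘ tail
    ; head = switchedHead
    }
    where
    open Switching φ
    switchedHead : Arc → Node ⊎ (∃[ n ] label n ≡ ⅋)
    switchedHead a with ⅋? (label (head a))
    ... | no _ = inj₁ (head a)
    ... | yes p with a ≟ choice (head a) p
    ...   | yes _ = inj₁ (head a)
    ...   | no _  = inj₂ (head a , p)

  ACC♯w : Set
  ACC♯w = ∀ φ → ¬ Graph.Cycle (switchingGraph φ)
              × Graph.NumberOfComponents (switchingGraph φ) (suc #bot)

  data Erasing (n : Node) : Set where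
    erasing : label n ≡ bot ⊎ label n ≡ ⅋ ⊎ label n ≡ • →
              (∀ a → head a ≡ n → Erasing (tail a)) →
              Erasing n

  [¬w⊗] : Set
  [¬w⊗] = ∀ a → label (head a) ≡ cut ⊎ label (head a) ≡ ⊗ → ¬ Erasing (tail a)

-- The data of a proof-structure except the order of its conclusions, without
-- any condition, so that disjoint unions can be formed directly.

record PreStructure : Set₁ where
  field
    graph : Graph
  open Graph graph public
  field
    label      : Node → Label
    left right : ∀ n → Ordered (label n) → Arc

⌊_⌋ : ProofStructure → PreStructure
⌊ R ⌋ = record { graph = graph ; label = label ; left = left ; right = right }
  where open ProofStructure R

_⊕_ : PreStructure → PreStructure → PreStructure
P ⊕ Q = record
  { graph = record
      { Node = P.Node ⊎ Q.Node
      ; Arc  = P.Arc ⊎ Q.Arc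
      ; tail = map-⊎ P.tail Q.tail
      ; head = map-⊎ P.head Q.head
      }
  ; label = [ P.label , Q.label ]
  ; left  = λ { (inj₁ n) o → inj₁ (P.left n o) ; (inj₂ n) o → inj₂ (Q.left n o) }
  ; right = λ { (inj₁ n) o → inj₁ (P.right n o) ; (inj₂ n) o → inj₂ (Q.right n o) }
  }
  where
  module P = PreStructure P
  module Q = PreStructure Q

-- `Extends P cs l q R n`: up to isomorphism, R is obtained from P by deleting
-- the nodes to which the arcs cs point, making these arcs the premises of a new
-- node n labelled l, and adding q new conclusions of n, each pointing to its
-- own new • node.

record Extends (P : PreStructure) (cs : List (PreStructure.Arc P))
               (l : Label) (q : ℕ)
               (R : PreStructure) (n : PreStructure.Node R) : Set where
  private
    module P = PreStructure P
    module R = PreStructure R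

  Kept : P.Node → Set
  Kept m = m ∉ map P.head cs

  field
    nodes : (∃ Kept ⊎ ⊤ ⊎ Fin q) ↔ R.Node
    arcs  : (P.Arc ⊎ Fin q) ↔ R.Arc

  kept : ∀ m → Kept m → R.Node
  kept m k = Inverse.to nodes (inj₁ (m , k))

  new• : Fin q → R.Node
  new• i = Inverse.to nodes (inj₂ (inj₂ i))

  old : P.Arc → R.Arc
  old a = Inverse.to arcs (inj₁ a)

  new : Fin q → R.Arc
  new i = Inverse.to arcs (inj₂ i)

  field
    new-node   : Inverse.to nodes (inj₂ (inj₁ tt)) ≡ n

    label-kept : ∀ m k → R.label (kept m k) ≡ P.label m
    label-n    : R.label n ≡ l
    label-new• : ∀ i → R.label (new• i) ≡ •

    tail-old   : ∀ a → Σ[ k ∈ Kept (P.tail a) ] R.tail (old a) ≡ kept (P.tail a) k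
    head-old   : ∀ a (k : Kept (P.head a)) → R.head (old a) ≡ kept (P.head a) k
    head-cs    : ∀ a → a ∈ cs → R.head (old a) ≡ n
    tail-new   : ∀ i → R.tail (new i) ≡ n
    head-new   : ∀ i → R.head (new i) ≡ new• i

    left-kept  : ∀ m k o o′ → R.left (kept m k) o′ ≡ old (P.left m o)
    right-kept : ∀ m k o o′ → R.right (kept m k) o′ ≡ old (P.right m o)

module _ (R : ProofStructure) (n : ProofStructure.Node R) where
  open ProofStructure R

  ConsistsOf : Set
  ConsistsOf = (∀ a → tail a ≡ n)
             × (∀ m → m ≡ n ⊎ (label m ≡ • × ∃[ a ] tail a ≡ n × head a ≡ m))

IsConclusion : (R : ProofStructure) → ProofStructure.Arc R → Set
IsConclusion R a = label (head a) ≡ •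
  where open ProofStructure R

data SequentialAt (R : ProofStructure) (n : ProofStructure.Node R) : Set

Sequential : ProofStructure → Set
Sequential R = ∃[ n ] SequentialAt R n

data SequentialAt R n where

  ax-seq : ProofStructure.label R n ≡ ax → ConsistsOf R n → SequentialAt R n

  one-seq : ProofStructure.label R n ≡ one → ConsistsOf R n → SequentialAt R n

  bot-seq : ∀ R₁ → Sequential R₁ →
            Extends ⌊ R₁ ⌋ [] bot 1 ⌊ R ⌋ n →
            SequentialAt R n

  ⅋-seq : ∀ R₁ → Sequential R₁ →
          ∀ c₁ c₂ → IsConclusion R₁ c₁ → IsConclusion R₁ c₂ → c₁ ≢ c₂ →
          (e : Extends ⌊ R₁ ⌋ (c₁ ∷ c₂ ∷ []) ⅋ 1 ⌊ R ⌋ n) →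
          (∀ o → ProofStructure.left R n o ≡ Extends.old e c₁) →
          (∀ o → ProofStructure.right R n o ≡ Extends.old e c₂) →
          SequentialAt R n

  ⊗-seq : ∀ R₁ R₂ → Sequential R₁ → Sequential R₂ →
          ∀ c₁ c₂ → IsConclusion R₁ c₁ → IsConclusion R₂ c₂ →
          (e : Extends (⌊ R₁ ⌋ ⊕ ⌊ R₂ ⌋) (inj₁ c₁ ∷ inj₂ c₂ ∷ []) ⊗ 1 ⌊ R ⌋ n) →
          (∀ o → ProofStructure.left R n o ≡ Extends.old e (inj₁ c₁)) →
          (∀ o → ProofStructure.right R n o ≡ Extends.old e (inj₂ c₂)) →
          SequentialAt R n

  cut-seq : ∀ R₁ R₂ → Sequential R₁ → Sequential R₂ →
            ∀ c₁ c₂ → IsConclusion R₁ c₁ → IsConclusion R₂ c₂ →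
            Extends (⌊ R₁ ⌋ ⊕ ⌊ R₂ ⌋) (inj₁ c₁ ∷ inj₂ c₂ ∷ []) cut 0 ⌊ R ⌋ n →
            SequentialAt R n

-- Sequentialization from the top down, in the style of Danos' contraction.
-- Maintain disjoint sets of nodes, each the node set of a sequential
-- proof-structure cut out of R.  Axioms and 1 start such sets; a ⊗ or cut whose
-- premises come from two of them merges them; a ⅋ whose premises each come from
-- one fixed set or from an erasing node is added to that set, after the erasing
-- nodes above it, which weakening can put into any set.
--
-- Suppose no step is possible and no set contains all live nodes, that is, all
-- nodes that are neither erasing nor •.  Restrict attention to switchings that
-- choose an erasing premise only at erasing nodes.  In such a switching graph
-- the erasing nodes form exactly one component per ⊥, so by the component count
-- the live nodes are connected.  Hence every set has an arc into a ⊗ or cut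
-- outside it: otherwise a switching that avoids the set at every ⅋ would isolate
-- it.  From an unprocessed node one can then always go up to a premise and, if
-- that premise lies in a set, through the set and down its exit to another
-- unprocessed node, never turning back: the other premise of that ⊗ or cut is
-- unprocessed.  In a finite graph this walk closes to a cycle.

module Submission where

open import Defs

open import Data.Bool using (Bool; true; false; if_then_else_; _∨_)
open import Data.Bool.Properties using (∨-zeroʳ) renaming (_≟_ to _≟ᵇ_)
open import Data.Empty using (⊥; ⊥-elim)
open import Data.Fin using (Fin; zero; suc; toℕ; _≟_)
open import Data.Fin.Induction using (spo-wellFounded)
open import Data.Fin.Properties using (any?; all?; pigeonhole; injective⇒≤)
open import Data.List using (List; []; _∷_; _++_; length; filter; allFin; lookup; map)
open import Data.List.Membership.Propositional using (_∈_; _∉_)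
open import Data.List.Membership.Propositional.Properties
  using (∈-allFin; ∈-filter⁺; ∈-filter⁻; ∈-lookup; ∈-map⁺; ∈-map⁻; ∈-++⁺ˡ; ∈-++⁺ʳ; ∈-++⁻)
open import Data.List.Membership.Propositional.Properties.WithK using (unique∧set⇒bag)
open import Data.List.Properties using (length-map)
open import Data.List.Relation.Binary.BagAndSetEquality using (∼bag⇒↭)
open import Data.List.Relation.Binary.Permutation.Propositional.Properties using (↭-length)
open import Data.List.Relation.Unary.All as All using (All; []; _∷_)
open import Data.List.Relation.Unary.AllPairs using ([]; _∷_)
open import Data.List.Relation.Unary.Any using (here; there; index)
open import Data.List.Relation.Unary.Any.Properties using (lookup-index)
open import Data.List.Relation.Unary.Unique.Propositional using (Unique)
import Data.List.Relation.Unary.Unique.Propositional.Properties as Unique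
open import Data.Nat using (ℕ; zero; suc; _+_; _≤_; _<_; z≤n; s≤s; s≤s⁻¹)
open import Data.Nat.Properties using (≤-refl; ≤-trans; m≤n⇒m≤1+n; 1+n≰n; m≤n⇒∃[o]m+o≡n; n<1+n; +-suc)
open import Data.Product using (Σ-syntax; ∃; ∃-syntax; _×_; _,_; proj₁; proj₂)
open import Data.Sum using (_⊎_; inj₁; inj₂) renaming ([_,_] to either; [_,_]′ to either′)
import Data.Sum.Properties as Sum
open import Data.Sum.Properties using (inj₁-injective; inj₂-injective)
open import Data.Unit using (⊤; tt)
open import Function.Base using (_∘_; const; id)
open import Function.Bundles using (_↔_; Inverse; Equivalence; mk⇔; mk↔ₛ′)
open import Function.Definitions using (Injective)
open import Relation.Binary.Construct.Closure.ReflexiveTransitive using (ε; _◅_)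
open import Relation.Binary.Construct.Closure.Symmetric using (SymClosure; fwd; bwd)
open import Induction.WellFounded using (WellFounded; Acc; acc)
open import Relation.Binary.Construct.Closure.Transitive using (TransClosure; [_]; _∷_) renaming (_++_ to _++⁺_)
open import Relation.Binary.Definitions using (DecidableEquality)
open import Relation.Binary.PropositionalEquality
  using (_≡_; _≢_; refl; sym; trans; cong; subst; isEquivalence)
open import Relation.Binary.PropositionalEquality.WithK using (≡-irrelevant)
open import Relation.Nullary using (¬_; Dec; yes; no; does; contradiction)
open import Relation.Nullary.Decidable using (_×-dec_; _⊎-dec_; ¬?; _→-dec_)
open import Relation.Unary using (Decidable)

-- The clauses for sequential proof-structures hold up to isomorphism and replace • nodes at each
-- step. The search therefore handles only subsets of the nodes of R with derivations `Seq`;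
-- proof-structures appear when a finished derivation is read off in `sequential`, and every
-- isomorphism comes from locating nodes and arcs in R.
--
-- A ⊗ or cut may merge only two different sets. Acyclicity ensures this: live nodes of one set are
-- joined by arcs inside it, so two premises from the same set would close a cycle. This
-- connectedness fails for erasing nodes, hence the condition that they never feed a ⊗ or cut.
--
-- Weakening can put an erasing node into any set, so an early choice could be the wrong one. An
-- erasing node therefore enters a set only together with the node below it, which leaves the
-- erasing nodes above an unprocessed ⅋ free. Those never claimed join the final set.
--
-- The component count is used twice: without live nodes there would be at most `#bot` components,
-- and an isolated set would make at least `#bot` + 2.

-- Finite enumerations, counting and bijections.

record Enumeration {B : Set} (P : B → Set) : Set where
  field
    size   : ℕ
    at     : Fin size → B
    at-inj : Injective _≡_ _≡_ at
    at-sat : ∀ i → P (at i)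
    find   : ∀ b → P b → ∃ λ i → at i ≡ b

lookup-injective : ∀ {B : Set} {xs : List B} → Unique xs → Injective _≡_ _≡_ (lookup xs)
lookup-injective (_ ∷ u)  {zero}  {zero}  eq = refl
lookup-injective (px ∷ u) {zero}  {suc j} eq = contradiction eq (All.lookup px (∈-lookup j))
lookup-injective (px ∷ u) {suc i} {zero}  eq = contradiction (sym eq) (All.lookup px (∈-lookup i))
lookup-injective (_ ∷ u)  {suc i} {suc j} eq = cong suc (lookup-injective u eq)

enumerate : ∀ {B : Set} {P : B → Set} (xs : List B) → Unique xs →
            (∀ {x} → x ∈ xs → P x) → (∀ {x} → P x → x ∈ xs) → Enumeration P
enumerate xs u sound complete = record
  { size   = length xs
  ; at     = lookup xs
  ; at-inj = lookup-injective u
  ; at-sat = λ i → sound (∈-lookup i)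
  ; find   = λ b p → index (complete p) , sym (lookup-index (complete p))
  }

-- Both lists are free of repetitions and have the same elements along `f`, so they are permutations
-- of each other. This transports the arities of R to its restrictions.
length-filter : ∀ {m} {B : Set} (f : Fin m → B) → Injective _≡_ _≡_ f →
                {P : Fin m → Set} (P? : Decidable P) {ys : List B} → Unique ys →
                (∀ i → P i → f i ∈ ys) → (∀ {y} → y ∈ ys → ∃ λ i → P i × f i ≡ y) →
                length (filter P? (allFin m)) ≡ length ys
length-filter {m} f f-inj {P} P? {ys} u into onto =
  trans (sym (length-map f (filter P? (allFin m))))
        (↭-length (∼bag⇒↭ (unique∧set⇒bag
          (Unique.map⁺ f-inj (Unique.filter⁺ P? (Unique.allFin⁺ m))) u (mk⇔ to from))))
  where
  to : ∀ {y} → y ∈ map f (filter P? (allFin m)) → y ∈ ys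
  to y∈ with i , i∈ , refl ← ∈-map⁻ f y∈ = into i (proj₂ (∈-filter⁻ P? {xs = allFin m} i∈))
  from : ∀ {y} → y ∈ ys → y ∈ map f (filter P? (allFin m))
  from y∈ with i , p , refl ← onto y∈ = ∈-map⁺ f (∈-filter⁺ P? (∈-allFin i) p)

-- With `f` and `g` giving places in R, structures that occupy the same places are in bijection.
-- Both bijections demanded by `Extends` arise in this way.
same-image⇒↔ : ∀ {A B L : Set} (f : A → L) (g : B → L) →
               Injective _≡_ _≡_ f → Injective _≡_ _≡_ g →
               (∀ a → ∃ λ b → g b ≡ f a) → (∀ b → ∃ λ a → f a ≡ g b) →
               Σ[ e ∈ A ↔ B ] (∀ a → g (Inverse.to e a) ≡ f a)
same-image⇒↔ f g f-inj g-inj to from =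
  mk↔ₛ′ (proj₁ ∘ to) (proj₁ ∘ from)
    (λ b → g-inj (trans (proj₂ (to _)) (proj₂ (from b))))
    (λ a → f-inj (trans (proj₂ (from _)) (proj₂ (to a)))) ,
  (proj₂ ∘ to)

module _ {B : Set} where

  empty-list : {xs : List B} → length xs ≡ 0 → ∀ {x} → x ∉ xs
  empty-list {[]} refl ()

  singleton-list : {xs : List B} → length xs ≡ 1 → ∀ {x y} → x ∈ xs → y ∈ xs → x ≡ y
  singleton-list {_ ∷ []} refl (here refl) (here refl) = refl

  inhabited-list : ∀ {k} {xs : List B} → length xs ≡ suc k → ∃ λ x → x ∈ xs
  inhabited-list {xs = x ∷ _} _ = x , here refl

  pair-list : {xs : List B} → length xs ≡ 2 → ∀ {x y z} → x ∈ xs → y ∈ xs → z ∈ xs →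
              x ≢ y → z ≡ x ⊎ z ≡ y
  pair-list {_ ∷ _ ∷ []} refl (here refl) (here refl) z≢ x≢y = contradiction refl x≢y
  pair-list {_ ∷ _ ∷ []} refl (here refl) (there (here refl)) (here refl) x≢y = inj₁ refl
  pair-list {_ ∷ _ ∷ []} refl (here refl) (there (here refl)) (there (here refl)) x≢y = inj₂ refl
  pair-list {_ ∷ _ ∷ []} refl (there (here refl)) (here refl) (here refl) x≢y = inj₂ refl
  pair-list {_ ∷ _ ∷ []} refl (there (here refl)) (here refl) (there (here refl)) x≢y = inj₁ refl
  pair-list {_ ∷ _ ∷ []} refl (there (here refl)) (there (here refl)) z≢ x≢y = contradiction refl x≢y

  two-of-pair-list : {xs : List B} → length xs ≡ 2 → Unique xs →
                     ∃ λ x → ∃ λ y → x ∈ xs × y ∈ xs × x ≢ y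
  two-of-pair-list {x ∷ y ∷ []} refl ((x≢y ∷ []) ∷ _) = x , y , here refl , there (here refl) , x≢y

-- Labels and the arcs at a node.

•? : (l : Label) → Dec (l ≡ •)
•? ax  = no λ ()
•? cut = no λ ()
•? one = no λ ()
•? bot = no λ ()
•? ⊗   = no λ ()
•? ⅋   = no λ ()
•? •   = yes refl

Ordered-irrelevant : ∀ {l} (o o′ : Ordered l) → o ≡ o′
Ordered-irrelevant ⊗-ordered ⊗-ordered = refl
Ordered-irrelevant ⅋-ordered ⅋-ordered = refl

data Premiseless : Label → Set where
  ax-premiseless  : Premiseless ax
  one-premiseless : Premiseless one
  bot-premiseless : Premiseless bot

data Conclusionless : Label → Set where
  cut-conclusionless : Conclusionless cut
  •-conclusionless   : Conclusionless •

data Single : Label → Set where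
  bot-single : Single bot
  ⊗-single   : Single ⊗
  ⅋-single   : Single ⅋

module Incidence (R : ProofStructure) where
  open ProofStructure R

  ∈-premises : ∀ {a n} → head a ≡ n → a ∈ premises n
  ∈-premises {a} {n} h = ∈-filter⁺ (λ a → head a ≟ n) (∈-allFin a) h

  premises-∈ : ∀ {a n} → a ∈ premises n → head a ≡ n
  premises-∈ {a} {n} a∈ = proj₂ (∈-filter⁻ (λ a → head a ≟ n) {xs = allFin #arcs} a∈)

  ∈-conclusions : ∀ {a n} → tail a ≡ n → a ∈ conclusions n
  ∈-conclusions {a} {n} h = ∈-filter⁺ (λ a → tail a ≟ n) (∈-allFin a) h

  conclusions-∈ : ∀ {a n} → a ∈ conclusions n → tail a ≡ n
  conclusions-∈ {a} {n} a∈ = proj₂ (∈-filter⁻ (λ a → tail a ≟ n) {xs = allFin #arcs} a∈)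

  private
    arity-at : ∀ {n l} → label n ≡ l → Arity l (length (premises n)) (length (conclusions n))
    arity-at {n} refl = arity n

    no-premises : ∀ {l p c} → Premiseless l → Arity l p c → p ≡ 0
    no-premises ax-premiseless ax-arity = refl
    no-premises one-premiseless one-arity = refl
    no-premises bot-premiseless bot-arity = refl

    no-conclusions : ∀ {l p c} → Conclusionless l → Arity l p c → c ≡ 0
    no-conclusions cut-conclusionless cut-arity = refl
    no-conclusions •-conclusionless •-arity = refl

    one-conclusion : ∀ {l p c} → Single l → Arity l p c → c ≡ 1
    one-conclusion bot-single bot-arity = refl
    one-conclusion ⊗-single ⊗-arity = refl
    one-conclusion ⅋-single ⅋-arity₁ = refl
    one-conclusion ⅋-single ⅋-arity₂ = refl

    •-one-premise : ∀ {p c} → Arity • p c → p ≡ 1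
    •-one-premise •-arity = refl

    cut-two-premises : ∀ {p c} → Arity cut p c → p ≡ 2
    cut-two-premises cut-arity = refl

    ⊗-two-premises : ∀ {p c} → Arity ⊗ p c → p ≡ 2
    ⊗-two-premises ⊗-arity = refl

    ordered-two-premises : ∀ {n} → Ordered (label n) → length (premises n) ≡ 2
    ordered-two-premises {n} o = go refl o
      where
      go : ∀ {l} → label n ≡ l → Ordered l → length (premises n) ≡ 2
      go eq ⊗-ordered = ⊗-two-premises (arity-at eq)
      go eq ⅋-ordered = ⅋-premises n eq

  premiseless : ∀ {n l} → label n ≡ l → Premiseless l → ∀ a → head a ≢ n
  premiseless eq pl a h = empty-list (no-premises pl (arity-at eq)) (∈-premises h)

  conclusionless : ∀ {n l} → label n ≡ l → Conclusionless l → ∀ a → tail a ≢ n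
  conclusionless eq cl a h = empty-list (no-conclusions cl (arity-at eq)) (∈-conclusions h)

  conclusion-unique : ∀ {n l} → label n ≡ l → Single l → ∀ {a b} →
                      tail a ≡ n → tail b ≡ n → a ≡ b
  conclusion-unique eq s ha hb =
    singleton-list (one-conclusion s (arity-at eq)) (∈-conclusions ha) (∈-conclusions hb)

  conclusion : ∀ {n l} → label n ≡ l → Single l → ∃ λ a → tail a ≡ n
  conclusion eq s with a , a∈ ← inhabited-list (one-conclusion s (arity-at eq)) = a , conclusions-∈ a∈

  •-premise : ∀ {n} → label n ≡ • → ∃ λ a → head a ≡ n
  •-premise eq with a , a∈ ← inhabited-list (•-one-premise (arity-at eq)) = a , premises-∈ a∈

  •-premise-unique : ∀ {n} → label n ≡ • → ∀ {a b} → head a ≡ n → head b ≡ n → a ≡ b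
  •-premise-unique eq ha hb =
    singleton-list (•-one-premise (arity-at eq)) (∈-premises ha) (∈-premises hb)

  cut-premises : ∀ {n} → label n ≡ cut → ∃ λ p → ∃ λ q → head p ≡ n × head q ≡ n × p ≢ q
  cut-premises {n} eq
    with p , q , p∈ , q∈ , p≢q ← two-of-pair-list (cut-two-premises (arity-at eq))
           (Unique.filter⁺ (λ a → head a ≟ n) (Unique.allFin⁺ #arcs))
    = p , q , premises-∈ p∈ , premises-∈ q∈ , p≢q

  cut-premise : ∀ {n p q} → label n ≡ cut → head p ≡ n → head q ≡ n → p ≢ q →
                ∀ a → head a ≡ n → a ≡ p ⊎ a ≡ q
  cut-premise eq hp hq p≢q a ha =
    pair-list (cut-two-premises (arity-at eq)) (∈-premises hp) (∈-premises hq) (∈-premises ha) p≢q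

  ordered-premise : ∀ {n} (o : Ordered (label n)) → ∀ a → head a ≡ n → a ≡ left n o ⊎ a ≡ right n o
  ordered-premise {n} o a ha =
    pair-list (ordered-two-premises o) (∈-premises (head-left n o)) (∈-premises (head-right n o))
              (∈-premises ha) (left≢right n o)

  no-loop : ∀ a → tail a ≢ head a
  no-loop a eq = acyclic (head a , [ a , eq , refl ])

-- Restrictions of a proof-structure to subsets of its nodes.

-- A subset T of the nodes of R, closed upwards and without • nodes, determines
-- a proof-structure whose nodes are those of T and a new • node for each arc
-- leaving T; that • node is represented by the arc itself.

module Restriction (R : ProofStructure) where
  open ProofStructure R
  open Incidence R

  Subset : Set
  Subset = Node → Bool

  infix 4 _∋_ _∋?_

  _∋_ : Subset → Node → Set
  T ∋ x = T x ≡ true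

  _∋?_ : ∀ T x → Dec (T ∋ x)
  T ∋? x = T x ≟ᵇ true

  UpClosed NoBullet : Subset → Set
  UpClosed T = ∀ a → T ∋ head a → T ∋ tail a
  NoBullet T = ∀ x → T ∋ x → label x ≢ •

  Loc : Subset → Node ⊎ Arc → Set
  Loc T (inj₁ x) = T ∋ x
  Loc T (inj₂ a) = T ∋ tail a × ¬ T ∋ head a

  labelLoc : Node ⊎ Arc → Label
  labelLoc = either label (const •)

  headLoc : Subset → Arc → Node ⊎ Arc
  headLoc T a = if T (head a) then inj₁ (head a) else inj₂ a

  headLoc-in : ∀ T {a} → T ∋ head a → headLoc T a ≡ inj₁ (head a)
  headLoc-in _ eq rewrite eq = refl

  headLoc-out : ∀ T {a} → ¬ T ∋ head a → headLoc T a ≡ inj₂ a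
  headLoc-out T {a} ∌ with T (head a)
  ... | false = refl
  ... | true  = contradiction refl ∌

  headLoc-Loc : ∀ {T a} → T ∋ tail a → Loc T (headLoc T a)
  headLoc-Loc {T} {a} t with T (head a) in eq
  ... | true  = eq
  ... | false = t , λ ∋h → contradiction (trans (sym eq) ∋h) λ ()

  headLoc≡inj₁ : ∀ {T a x} → headLoc T a ≡ inj₁ x → head a ≡ x
  headLoc≡inj₁ {T} {a} eq with T (head a)
  headLoc≡inj₁ refl | true = refl

  headLoc≡inj₂ : ∀ {T a b} → headLoc T a ≡ inj₂ b → a ≡ b
  headLoc≡inj₂ {T} {a} eq with T (head a)
  headLoc≡inj₂ refl | false = refl

  -- A relation rather than a construction, because it has to cover the structures made by `Build`,
  -- disjoint unions of two of them, which are only prestructures, and R itself.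
  record Restricts (T : Subset) (P : PreStructure) : Set where
    private module P = PreStructure P
    field
      loc : P.Node → Node ⊎ Arc
      arc : P.Arc → Arc

      loc-inj  : Injective _≡_ _≡_ loc
      loc-into : ∀ p → Loc T (loc p)
      loc-onto : ∀ l → Loc T l → ∃ λ p → loc p ≡ l

      arc-inj  : Injective _≡_ _≡_ arc
      arc-into : ∀ a → T ∋ tail (arc a)
      arc-onto : ∀ b → T ∋ tail b → ∃ λ a → arc a ≡ b

      label-loc : ∀ p → P.label p ≡ labelLoc (loc p)
      tail-loc  : ∀ a → loc (P.tail a) ≡ inj₁ (tail (arc a))
      head-loc  : ∀ a → loc (P.head a) ≡ headLoc T (arc a)
      left-loc  : ∀ p o {x} o′ → loc p ≡ inj₁ x → arc (P.left p o) ≡ left x o′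
      right-loc : ∀ p o {x} o′ → loc p ≡ inj₁ x → arc (P.right p o) ≡ right x o′

  ordered-loc : ∀ {T P} (RP : Restricts T P) → ∀ p → Ordered (PreStructure.label P p) →
                ∃ λ x → Restricts.loc RP p ≡ inj₁ x × Ordered (label x)
  ordered-loc RP p o with loc p | subst Ordered (label-loc p) o
    where open Restricts RP
  ... | inj₁ x | o′ = x , refl , o′
  ... | inj₂ a | o′ = contradiction o′ λ ()

  module Build (T : Subset) (up : UpClosed T) (no• : NoBullet T) where

    isLoc? : ∀ a → Dec (Loc T (inj₂ a))
    isLoc? a = (T ∋? tail a) ×-dec ¬? (T ∋? head a)

    locs : Enumeration (Loc T)
    locs = enumerate (map inj₁ inner ++ map inj₂ outer)
      (Unique.++⁺ (Unique.map⁺ inj₁-injective (Unique.filter⁺ (T ∋?_) (Unique.allFin⁺ #nodes)))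
                  (Unique.map⁺ inj₂-injective (Unique.filter⁺ isLoc? (Unique.allFin⁺ #arcs)))
                  disjoint)
      sound complete
      where
      inner : List Node
      inner = filter (T ∋?_) (allFin #nodes)
      outer : List Arc
      outer = filter isLoc? (allFin #arcs)
      disjoint : ∀ {l} → ¬ (l ∈ map inj₁ inner × l ∈ map inj₂ outer)
      disjoint (l∈ , l∈′) with _ , _ , refl ← ∈-map⁻ inj₁ l∈ with _ , _ , () ← ∈-map⁻ inj₂ l∈′
      sound : ∀ {l} → l ∈ map inj₁ inner ++ map inj₂ outer → Loc T l
      sound l∈ with ∈-++⁻ (map inj₁ inner) l∈
      ... | inj₁ l∈′ with _ , x∈ , refl ← ∈-map⁻ inj₁ l∈′ = proj₂ (∈-filter⁻ (T ∋?_) {xs = allFin #nodes} x∈)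
      ... | inj₂ l∈′ with _ , x∈ , refl ← ∈-map⁻ inj₂ l∈′ = proj₂ (∈-filter⁻ isLoc? {xs = allFin #arcs} x∈)
      complete : ∀ {l} → Loc T l → l ∈ map inj₁ inner ++ map inj₂ outer
      complete {inj₁ x} p = ∈-++⁺ˡ (∈-map⁺ inj₁ (∈-filter⁺ (T ∋?_) (∈-allFin x) p))
      complete {inj₂ a} p = ∈-++⁺ʳ (map inj₁ inner) (∈-map⁺ inj₂ (∈-filter⁺ isLoc? (∈-allFin a) p))

    arcs : Enumeration (λ a → T ∋ tail a)
    arcs = enumerate (filter inner? (allFin #arcs)) (Unique.filter⁺ inner? (Unique.allFin⁺ #arcs))
      (λ a∈ → proj₂ (∈-filter⁻ inner? {xs = allFin #arcs} a∈)) (λ {a} → ∈-filter⁺ inner? (∈-allFin a))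
      where
      inner? : ∀ a → Dec (T ∋ tail a)
      inner? a = T ∋? tail a

    open Enumeration locs using ()
      renaming (size to #locs; at to loc; at-inj to loc-inj; at-sat to loc-into; find to loc-onto)
    open Enumeration arcs using ()
      renaming (size to #inner; at to arc; at-inj to arc-inj; at-sat to arc-into; find to arc-onto)

    source target : Fin #inner → Fin #locs
    source a = proj₁ (loc-onto (inj₁ (tail (arc a))) (arc-into a))
    target a = proj₁ (loc-onto (headLoc T (arc a)) (headLoc-Loc (arc-into a)))

    source-loc : ∀ a → loc (source a) ≡ inj₁ (tail (arc a))
    source-loc a = proj₂ (loc-onto (inj₁ (tail (arc a))) (arc-into a))

    target-loc : ∀ a → loc (target a) ≡ headLoc T (arc a)
    target-loc a = proj₂ (loc-onto (headLoc T (arc a)) (headLoc-Loc (arc-into a)))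

    flg : FiniteLabelledGraph
    flg = record { #nodes = #locs ; #arcs = #inner ; src = source ; tgt = target
                 ; label = labelLoc ∘ loc }

    private module F = FiniteLabelledGraph flg

    -- Upward closure preserves the arity: every premise of an inner node has its tail in T and so
    -- is an arc of the restriction.
    premises-inner : ∀ {p x} → loc p ≡ inj₁ x → T ∋ x → length (F.premises p) ≡ length (premises x)
    premises-inner {p} {x} eq ∋x =
      length-filter arc arc-inj (λ a → target a ≟ p)
        (Unique.filter⁺ (λ a → head a ≟ x) (Unique.allFin⁺ #arcs)) into onto
      where
      into : ∀ a → target a ≡ p → arc a ∈ premises x
      into a h = ∈-premises (headLoc≡inj₁ {T} (trans (sym (target-loc a)) (trans (cong loc h) eq)))
      onto : ∀ {b} → b ∈ premises x → ∃ λ a → target a ≡ p × arc a ≡ b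
      onto {b} b∈ with refl ← premises-∈ b∈ with a , refl ← arc-onto b (up b ∋x) =
        a , loc-inj (trans (target-loc a) (trans (headLoc-in T ∋x) (sym eq))) , refl

    premises-outer : ∀ {p b} → loc p ≡ inj₂ b → Loc T (inj₂ b) → length (F.premises p) ≡ 1
    premises-outer {p} {b} eq (∋t , ∌h) =
      length-filter arc arc-inj (λ a → target a ≟ p) {b ∷ []} ([] ∷ []) into onto
      where
      into : ∀ a → target a ≡ p → arc a ∈ b ∷ []
      into a h = here (headLoc≡inj₂ {T} (trans (sym (target-loc a)) (trans (cong loc h) eq)))
      onto : ∀ {c} → c ∈ b ∷ [] → ∃ λ a → target a ≡ p × arc a ≡ c
      onto (here refl) with a , refl ← arc-onto b ∋t =
        a , loc-inj (trans (target-loc a) (trans (headLoc-out T ∌h) (sym eq))) , refl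

    conclusions-inner : ∀ {p x} → loc p ≡ inj₁ x → T ∋ x → length (F.conclusions p) ≡ length (conclusions x)
    conclusions-inner {p} {x} eq ∋x =
      length-filter arc arc-inj (λ a → source a ≟ p)
        (Unique.filter⁺ (λ a → tail a ≟ x) (Unique.allFin⁺ #arcs)) into onto
      where
      into : ∀ a → source a ≡ p → arc a ∈ conclusions x
      into a h = ∈-conclusions (inj₁-injective (trans (sym (source-loc a)) (trans (cong loc h) eq)))
      onto : ∀ {b} → b ∈ conclusions x → ∃ λ a → source a ≡ p × arc a ≡ b
      onto {b} b∈ with refl ← conclusions-∈ b∈ with a , refl ← arc-onto b ∋x =
        a , loc-inj (trans (source-loc a) (sym eq)) , refl

    conclusions-outer : ∀ {p b} → loc p ≡ inj₂ b → length (F.conclusions p) ≡ 0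
    conclusions-outer {p} eq =
      length-filter arc arc-inj (λ a → source a ≟ p) {[]} [] into λ ()
      where
      into : ∀ a → source a ≡ p → arc a ∈ []
      into a h = contradiction (trans (sym (source-loc a)) (trans (cong loc h) eq)) λ ()

    arity′ : ∀ p → Arity (F.label p) (length (F.premises p)) (length (F.conclusions p))
    arity′ p with loc p in eq | loc-into p
    ... | inj₁ x | ∋x rewrite premises-inner eq ∋x | conclusions-inner eq ∋x = arity x
    ... | inj₂ b | ∋b rewrite premises-outer eq ∋b | conclusions-outer eq = •-arity

    link : ∀ {p q y} → F.Link p q → loc q ≡ inj₁ y → ∃ λ x → loc p ≡ inj₁ x × Link x y
    link (a , refl , refl) eq =
      tail (arc a) , source-loc a , arc a , refl , headLoc≡inj₁ {T} (trans (sym (target-loc a)) eq)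

    links : ∀ {p q y} → TransClosure F.Link p q → loc q ≡ inj₁ y →
            ∃ λ x → loc p ≡ inj₁ x × TransClosure Link x y
    links [ l ] eq with x , eq′ , l′ ← link l eq = x , eq′ , [ l′ ]
    links (l ∷ ls) eq with y , eq′ , ls′ ← links ls eq with x , eq″ , l′ ← link l eq′ = x , eq″ , l′ ∷ ls′

    inner-source : ∀ {p q} → TransClosure F.Link p q → ∃ λ x → loc p ≡ inj₁ x
    inner-source [ a , refl , _ ] = _ , source-loc a
    inner-source ((a , refl , _) ∷ _) = _ , source-loc a

    -- Arcs of the restriction start at inner nodes, so all nodes of a directed cycle are inner and
    -- the cycle already lies in R.
    acyclic′ : ¬ F.HasDirectedCycle
    acyclic′ (p , ls) with x , eq ← inner-source ls with y , eq′ , ls′ ← links ls eq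
      with refl ← inj₁-injective (trans (sym eq) eq′) = acyclic (x , ls′)

    ordered′ : ∀ p → Ordered (F.label p) → ∃ λ x → loc p ≡ inj₁ x × T ∋ x × Ordered (label x)
    ordered′ p o with loc p in eq | loc-into p
    ... | inj₁ x | ∋x = x , refl , ∋x , o
    ... | inj₂ _ | _ = contradiction o λ ()

    module Premise (premise : ∀ n → Ordered (label n) → Arc)
                   (head-premise : ∀ n o → head (premise n o) ≡ n) where

      found : ∀ p (o : Ordered (F.label p)) →
              ∃ λ a → target a ≡ p × (∀ {x} o′ → loc p ≡ inj₁ x → arc a ≡ premise x o′)
      found p o with x , eq , ∋x , o′ ← ordered′ p o
        with a , eq′ ← arc-onto (premise x o′) (up _ (subst (T ∋_) (sym (head-premise x o′)) ∋x)) =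
        a , loc-inj target≡ , same
        where
        head≡ : head (arc a) ≡ x
        head≡ = trans (cong head eq′) (head-premise x o′)
        target≡ : loc (target a) ≡ loc p
        target≡ = trans (target-loc a)
          (trans (headLoc-in T (subst (T ∋_) (sym head≡) ∋x)) (trans (cong inj₁ head≡) (sym eq)))
        same : ∀ {y} o″ → loc p ≡ inj₁ y → arc a ≡ premise y o″
        same o″ eq″ with refl ← inj₁-injective (trans (sym eq) eq″) =
          trans eq′ (cong (premise x) (Ordered-irrelevant o′ o″))

    module Left = Premise left head-left
    module Right = Premise right head-right

    ⅋-premises′ : ∀ p → F.label p ≡ ⅋ → length (F.premises p) ≡ 2
    ⅋-premises′ p lab with loc p in eq | loc-into p
    ... | inj₁ x | ∋x = trans (premises-inner eq ∋x) (⅋-premises x lab)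
    ... | inj₂ _ | _ = contradiction lab λ ()

    left≢right′ : ∀ p o → proj₁ (Left.found p o) ≢ proj₁ (Right.found p o)
    left≢right′ p o eq = let x , eq′ , ∋x , o′ = ordered′ p o in
      left≢right x o′ (trans (sym (proj₂ (proj₂ (Left.found p o)) o′ eq′))
                      (trans (cong arc eq) (proj₂ (proj₂ (Right.found p o)) o′ eq′)))

    isConclusion? : ∀ a → Dec (F.label (target a) ≡ •)
    isConclusion? a = •? (F.label (target a))

    restriction : ProofStructure
    restriction = record
      { linearLogicalGraph = record { labelledGraph = flg ; arity = arity′ ; acyclic = acyclic′ }
      ; ⅋-premises = ⅋-premises′
      ; left = λ p o → proj₁ (Left.found p o)
      ; right = λ p o → proj₁ (Right.found p o)
      ; head-left = λ p o → proj₁ (proj₂ (Left.found p o))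
      ; head-right = λ p o → proj₁ (proj₂ (Right.found p o))
      ; left≢right = left≢right′
      ; conclusionList = filter isConclusion? (allFin #inner)
      ; conclusionUnique = Unique.filter⁺ isConclusion? (Unique.allFin⁺ #inner)
      ; conclusionComplete = λ a → mk⇔
          (λ a∈ → proj₂ (∈-filter⁻ isConclusion? {xs = allFin #inner} a∈))
          (∈-filter⁺ isConclusion? (∈-allFin a))
      }

    restricts : Restricts T ⌊ restriction ⌋
    restricts = record
      { loc = loc ; arc = arc
      ; loc-inj = loc-inj ; loc-into = loc-into ; loc-onto = loc-onto
      ; arc-inj = arc-inj ; arc-into = arc-into ; arc-onto = arc-onto
      ; label-loc = λ _ → refl
      ; tail-loc = source-loc
      ; head-loc = target-loc
      ; left-loc = λ p o o′ → proj₂ (proj₂ (Left.found p o)) o′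
      ; right-loc = λ p o o′ → proj₂ (proj₂ (Right.found p o)) o′
      }

  open Build using (restriction; restricts) public

-- Disjoint unions of restrictions and the addition of one node.

∨-split : ∀ {b c} → b ∨ c ≡ true → b ≡ true ⊎ c ≡ true
∨-split {true}  _ = inj₁ refl
∨-split {false} c = inj₂ c

∨-left : ∀ {b c} → b ≡ true → b ∨ c ≡ true
∨-left refl = refl

∨-right : ∀ {b c} → c ≡ true → b ∨ c ≡ true
∨-right {b} refl = ∨-zeroʳ b

module Composition (R : ProofStructure) where
  open ProofStructure R
  open Incidence R
  open Restriction R

  infixl 6 _∪_

  _∪_ : Subset → Subset → Subset
  (S₁ ∪ S₂) x = S₁ x ∨ S₂ x

  ∪-upClosed : ∀ {S₁ S₂} → UpClosed S₁ → UpClosed S₂ → UpClosed (S₁ ∪ S₂)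
  ∪-upClosed {S₁} {S₂} up₁ up₂ a ∋h with ∨-split {S₁ (head a)} ∋h
  ... | inj₁ ∋h₁ = ∨-left (up₁ a ∋h₁)
  ... | inj₂ ∋h₂ = ∨-right {S₁ (tail a)} (up₂ a ∋h₂)

  -- An arc that leaves one set cannot enter the other, since upward closure would put its tail into
  -- both. Hence the arcs leaving the union are exactly those leaving either set, and no • node is
  -- lost.
  sum-restricts : ∀ {S₁ S₂ P Q} → UpClosed S₁ → UpClosed S₂ → (∀ x → S₁ ∋ x → ¬ S₂ ∋ x) →
                  Restricts S₁ P → Restricts S₂ Q → Restricts (S₁ ∪ S₂) (P ⊕ Q)
  sum-restricts {S₁} {S₂} {P} {Q} up₁ up₂ disj RP RQ = record
    { loc = loc ; arc = arc
    ; loc-inj = loc-inj ; loc-into = loc-into ; loc-onto = loc-onto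
    ; arc-inj = arc-inj ; arc-into = arc-into ; arc-onto = arc-onto
    ; label-loc = either P.label-loc Q.label-loc
    ; tail-loc = either P.tail-loc Q.tail-loc
    ; head-loc = head-loc
    ; left-loc = λ { (inj₁ p) → P.left-loc p ; (inj₂ q) → Q.left-loc q }
    ; right-loc = λ { (inj₁ p) → P.right-loc p ; (inj₂ q) → Q.right-loc q }
    }
    where
    module P where
      open PreStructure P public using (Node; Arc; head)
      open Restricts RP public
    module Q where
      open PreStructure Q public using (Node; Arc; head)
      open Restricts RQ public
    loc : P.Node ⊎ Q.Node → Node ⊎ Arc
    loc = either P.loc Q.loc
    arc : P.Arc ⊎ Q.Arc → Arc
    arc = either P.arc Q.arc

    disjoint : ∀ l → Loc S₁ l → ¬ Loc S₂ l
    disjoint (inj₁ x) = disj x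
    disjoint (inj₂ a) (∋t , _) (∋t′ , _) = disj (tail a) ∋t ∋t′

    loc-inj : Injective _≡_ _≡_ loc
    loc-inj {inj₁ p} {inj₁ q} eq = cong inj₁ (P.loc-inj eq)
    loc-inj {inj₂ p} {inj₂ q} eq = cong inj₂ (Q.loc-inj eq)
    loc-inj {inj₁ p} {inj₂ q} eq = contradiction (subst (Loc S₂) (sym eq) (Q.loc-into q)) (disjoint _ (P.loc-into p))
    loc-inj {inj₂ q} {inj₁ p} eq = contradiction (subst (Loc S₂) eq (Q.loc-into q)) (disjoint _ (P.loc-into p))

    inl : ∀ l → Loc S₁ l → Loc (S₁ ∪ S₂) l
    inl (inj₁ x) = ∨-left
    inl (inj₂ a) (∋t , ∌h) =
      ∨-left ∋t , λ ∋h → either ∌h (λ ∋h₂ → disj _ ∋t (up₂ a ∋h₂)) (∨-split {S₁ (head a)} ∋h)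

    inr : ∀ l → Loc S₂ l → Loc (S₁ ∪ S₂) l
    inr (inj₁ x) = ∨-right {S₁ x}
    inr (inj₂ a) (∋t , ∌h) =
      ∨-right {S₁ (tail a)} ∋t , λ ∋h → either (λ ∋h₁ → disj _ (up₁ a ∋h₁) ∋t) ∌h (∨-split {S₁ (head a)} ∋h)

    split : ∀ l → Loc (S₁ ∪ S₂) l → Loc S₁ l ⊎ Loc S₂ l
    split (inj₁ x) = ∨-split
    split (inj₂ a) (∋t , ∌h) with ∨-split {S₁ (tail a)} ∋t
    ... | inj₁ ∋t₁ = inj₁ (∋t₁ , ∌h ∘ ∨-left)
    ... | inj₂ ∋t₂ = inj₂ (∋t₂ , ∌h ∘ ∨-right {S₁ (head a)})

    loc-into : ∀ p → Loc (S₁ ∪ S₂) (loc p)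
    loc-into (inj₁ p) = inl _ (P.loc-into p)
    loc-into (inj₂ q) = inr _ (Q.loc-into q)

    loc-onto : ∀ l → Loc (S₁ ∪ S₂) l → ∃ λ p → loc p ≡ l
    loc-onto l l∈ with split l l∈
    ... | inj₁ l∈₁ with p , eq ← P.loc-onto l l∈₁ = inj₁ p , eq
    ... | inj₂ l∈₂ with q , eq ← Q.loc-onto l l∈₂ = inj₂ q , eq

    arc-inj : Injective _≡_ _≡_ arc
    arc-inj {inj₁ a} {inj₁ b} eq = cong inj₁ (P.arc-inj eq)
    arc-inj {inj₂ a} {inj₂ b} eq = cong inj₂ (Q.arc-inj eq)
    arc-inj {inj₁ a} {inj₂ b} eq =
      contradiction (subst (λ c → S₂ ∋ tail c) (sym eq) (Q.arc-into b)) (disj _ (P.arc-into a))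
    arc-inj {inj₂ a} {inj₁ b} eq =
      contradiction (subst (λ c → S₂ ∋ tail c) eq (Q.arc-into a)) (disj _ (P.arc-into b))

    arc-into : ∀ a → S₁ ∪ S₂ ∋ tail (arc a)
    arc-into (inj₁ a) = ∨-left (P.arc-into a)
    arc-into (inj₂ a) = ∨-right {S₁ (tail (Q.arc a))} (Q.arc-into a)

    arc-onto : ∀ b → S₁ ∪ S₂ ∋ tail b → ∃ λ a → arc a ≡ b
    arc-onto b ∋t with ∨-split {S₁ (tail b)} ∋t
    ... | inj₁ ∋t₁ with a , eq ← P.arc-onto b ∋t₁ = inj₁ a , eq
    ... | inj₂ ∋t₂ with a , eq ← Q.arc-onto b ∋t₂ = inj₂ a , eq

    headLoc-∪ˡ : ∀ a → S₁ ∋ tail a → headLoc S₁ a ≡ headLoc (S₁ ∪ S₂) a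
    headLoc-∪ˡ a ∋t with S₁ ∋? head a
    ... | yes ∋h = trans (headLoc-in S₁ ∋h) (sym (headLoc-in (S₁ ∪ S₂) (∨-left ∋h)))
    ... | no ∌h = trans (headLoc-out S₁ ∌h) (sym (headLoc-out (S₁ ∪ S₂) (proj₂ (inl (inj₂ a) (∋t , ∌h)))))

    headLoc-∪ʳ : ∀ a → S₂ ∋ tail a → headLoc S₂ a ≡ headLoc (S₁ ∪ S₂) a
    headLoc-∪ʳ a ∋t with S₂ ∋? head a
    ... | yes ∋h = trans (headLoc-in S₂ ∋h) (sym (headLoc-in (S₁ ∪ S₂) (∨-right {S₁ (head a)} ∋h)))
    ... | no ∌h = trans (headLoc-out S₂ ∌h) (sym (headLoc-out (S₁ ∪ S₂) (proj₂ (inr (inj₂ a) (∋t , ∌h)))))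

    head-loc : ∀ a → loc (PreStructure.head (P ⊕ Q) a) ≡ headLoc (S₁ ∪ S₂) (arc a)
    head-loc (inj₁ a) = trans (P.head-loc a) (headLoc-∪ˡ _ (P.arc-into a))
    head-loc (inj₂ a) = trans (Q.head-loc a) (headLoc-∪ʳ _ (Q.arc-into a))

  module Extension
    {S T : Subset} {P Q : PreStructure} (RP : Restricts S P) (RQ : Restricts T Q) (n : Node)
    (S∌n : ¬ S ∋ n) (T∋n : T ∋ n) (S⊆T : ∀ {x} → S ∋ x → T ∋ x) (T⊆S+n : ∀ {x} → T ∋ x → S ∋ x ⊎ x ≡ n)
    (up : UpClosed S) (premises∈S : ∀ a → head a ≡ n → S ∋ tail a)
    (cs : List (PreStructure.Arc P))
    (cs-sound : ∀ {c} → c ∈ cs → head (Restricts.arc RP c) ≡ n)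
    (cs-complete : ∀ {c} → head (Restricts.arc RP c) ≡ n → c ∈ cs)
    (q : ℕ) (conc : Fin q → Arc) (conc-inj : Injective _≡_ _≡_ conc)
    (conc-tail : ∀ i → tail (conc i) ≡ n) (conc-onto : ∀ a → tail a ≡ n → ∃ λ i → conc i ≡ a)
    where

    private
      module P where
        open PreStructure P public
        open Restricts RP public
      module Q where
        open PreStructure Q public
        open Restricts RQ public

    node : Q.Node
    node = proj₁ (Q.loc-onto (inj₁ n) T∋n)

    node-loc : Q.loc node ≡ inj₁ n
    node-loc = proj₂ (Q.loc-onto (inj₁ n) T∋n)

    Kept : P.Node → Set
    Kept m = m ∉ map P.head cs

    cs-loc : ∀ {c} → c ∈ cs → P.loc (P.head c) ≡ inj₂ (P.arc c)
    cs-loc {c} c∈ = trans (P.head-loc c) (headLoc-out S (λ ∋h → S∌n (subst (S ∋_) (cs-sound c∈) ∋h)))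

    inner-kept : ∀ {m x} → P.loc m ≡ inj₁ x → Kept m
    inner-kept eq m∈ with c , c∈ , refl ← ∈-map⁻ P.head m∈ =
      contradiction (trans (sym eq) (cs-loc c∈)) λ ()

    outer-kept : ∀ {m a} → P.loc m ≡ inj₂ a → head a ≢ n → Kept m
    outer-kept {m} {a} eq h≢n m∈ with c , c∈ , refl ← ∈-map⁻ P.head m∈ =
      h≢n (trans (cong head (inj₂-injective (trans (sym eq) (cs-loc c∈)))) (cs-sound c∈))

    kept-head : ∀ {m a} → P.loc m ≡ inj₂ a → Kept m → head a ≢ n
    kept-head {m} {a} eq k h≡n with ∋t , _ ← subst (Loc S) eq (P.loc-into m) with c , refl ← P.arc-onto a ∋t =
      k (subst (_∈ map P.head cs) (P.loc-inj (trans (cs-loc c∈) (sym eq))) (∈-map⁺ P.head c∈))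
      where c∈ = cs-complete h≡n

    -- The place in R of each node of the extended structure; the new • nodes are represented by the
    -- conclusions of n. The image is that of `Q.loc`, which is what makes `nodes` a bijection.
    keep : ∃ Kept ⊎ ⊤ ⊎ Fin q → Node ⊎ Arc
    keep (inj₁ (m , _)) = P.loc m
    keep (inj₂ (inj₁ _)) = inj₁ n
    keep (inj₂ (inj₂ i)) = inj₂ (conc i)

    S∌conc : ∀ i → ¬ S ∋ tail (conc i)
    S∌conc i ∋t = S∌n (subst (S ∋_) (conc-tail i) ∋t)

    -- If the head were in S, upward closure would put n into S; if it were n, there would be a
    -- loop.
    T∌conc : ∀ i → ¬ T ∋ head (conc i)
    T∌conc i ∋h with T⊆S+n ∋h
    ... | inj₁ ∋h′ = S∌conc i (up _ ∋h′)
    ... | inj₂ h≡n = no-loop (conc i) (trans (conc-tail i) (sym h≡n))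

    keep-into : ∀ m → Loc T (keep m)
    keep-into (inj₁ (m , k)) with P.loc m in eq | P.loc-into m
    ... | inj₁ x | ∋x = S⊆T ∋x
    ... | inj₂ a | ∋t , ∌h = S⊆T ∋t , λ ∋h → either ∌h (kept-head eq k) (T⊆S+n ∋h)
    keep-into (inj₂ (inj₁ _)) = T∋n
    keep-into (inj₂ (inj₂ i)) = subst (T ∋_) (sym (conc-tail i)) T∋n , T∌conc i

    keep-inj : Injective _≡_ _≡_ keep
    keep-inj {inj₁ (m , k)} {inj₁ (m′ , k′)} eq with refl ← P.loc-inj eq = refl
    keep-inj {inj₁ (m , k)} {inj₂ (inj₁ _)} eq = contradiction (subst (Loc S) eq (P.loc-into m)) S∌n
    keep-inj {inj₁ (m , k)} {inj₂ (inj₂ i)} eq = contradiction (proj₁ (subst (Loc S) eq (P.loc-into m))) (S∌conc i)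
    keep-inj {inj₂ (inj₁ _)} {inj₁ (m , k)} eq = contradiction (subst (Loc S) (sym eq) (P.loc-into m)) S∌n
    keep-inj {inj₂ (inj₂ i)} {inj₁ (m , k)} eq = contradiction (proj₁ (subst (Loc S) (sym eq) (P.loc-into m))) (S∌conc i)
    keep-inj {inj₂ (inj₁ _)} {inj₂ (inj₁ _)} eq = refl
    keep-inj {inj₂ (inj₂ i)} {inj₂ (inj₂ j)} eq = cong (inj₂ ∘ inj₂) (conc-inj (inj₂-injective eq))

    keep-onto : ∀ l → Loc T l → ∃ λ m → keep m ≡ l
    keep-onto (inj₁ x) ∋x with T⊆S+n ∋x
    ... | inj₁ ∋x′ with m , eq ← P.loc-onto (inj₁ x) ∋x′ = inj₁ (m , inner-kept eq) , eq
    ... | inj₂ refl = inj₂ (inj₁ tt) , refl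
    keep-onto (inj₂ a) (∋t , ∌h) with T⊆S+n ∋t
    ... | inj₁ ∋t′ with m , eq ← P.loc-onto (inj₂ a) (∋t′ , ∌h ∘ S⊆T) =
      inj₁ (m , outer-kept eq (λ h≡n → ∌h (subst (T ∋_) (sym h≡n) T∋n))) , eq
    ... | inj₂ t≡n with i , refl ← conc-onto a t≡n = inj₂ (inj₂ i) , refl

    keepArc : P.Arc ⊎ Fin q → Arc
    keepArc = either P.arc conc

    keepArc-inj : Injective _≡_ _≡_ keepArc
    keepArc-inj {inj₁ a} {inj₁ b} eq = cong inj₁ (P.arc-inj eq)
    keepArc-inj {inj₁ a} {inj₂ i} eq = contradiction (subst (λ c → S ∋ tail c) eq (P.arc-into a)) (S∌conc i)
    keepArc-inj {inj₂ i} {inj₁ b} eq = contradiction (subst (λ c → S ∋ tail c) (sym eq) (P.arc-into b)) (S∌conc i)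
    keepArc-inj {inj₂ i} {inj₂ j} eq = cong inj₂ (conc-inj eq)

    keepArc-into : ∀ a → T ∋ tail (keepArc a)
    keepArc-into (inj₁ a) = S⊆T (P.arc-into a)
    keepArc-into (inj₂ i) = subst (T ∋_) (sym (conc-tail i)) T∋n

    keepArc-onto : ∀ b → T ∋ tail b → ∃ λ a → keepArc a ≡ b
    keepArc-onto b ∋t with T⊆S+n ∋t
    ... | inj₁ ∋t′ with a , eq ← P.arc-onto b ∋t′ = inj₁ a , eq
    ... | inj₂ t≡n with i , eq ← conc-onto b t≡n = inj₂ i , eq

    nodes : Σ[ e ∈ (∃ Kept ⊎ ⊤ ⊎ Fin q) ↔ Q.Node ] (∀ m → Q.loc (Inverse.to e m) ≡ keep m)
    nodes = same-image⇒↔ keep Q.loc keep-inj Q.loc-inj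
      (λ m → Q.loc-onto _ (keep-into m)) (λ p → keep-onto _ (Q.loc-into p))

    arcs : Σ[ e ∈ (P.Arc ⊎ Fin q) ↔ Q.Arc ] (∀ a → Q.arc (Inverse.to e a) ≡ keepArc a)
    arcs = same-image⇒↔ keepArc Q.arc keepArc-inj Q.arc-inj
      (λ a → Q.arc-onto _ (keepArc-into a)) (λ b → keepArc-onto _ (Q.arc-into b))

    kept : ∀ m → Kept m → Q.Node
    kept m k = Inverse.to (proj₁ nodes) (inj₁ (m , k))

    kept-loc : ∀ m k → Q.loc (kept m k) ≡ P.loc m
    kept-loc m k = proj₂ nodes (inj₁ (m , k))

    old : P.Arc → Q.Arc
    old a = Inverse.to (proj₁ arcs) (inj₁ a)

    old-arc : ∀ a → Q.arc (old a) ≡ P.arc a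
    old-arc a = proj₂ arcs (inj₁ a)

    new : Fin q → Q.Arc
    new i = Inverse.to (proj₁ arcs) (inj₂ i)

    new-arc : ∀ i → Q.arc (new i) ≡ conc i
    new-arc i = proj₂ arcs (inj₂ i)

    -- Passing from S to T adds only n, so the place of a head changes only for premises of n, and
    -- the • nodes of these are not kept.
    head-kept : ∀ a → Kept (P.head a) → headLoc S (P.arc a) ≡ headLoc T (P.arc a)
    head-kept a k with S ∋? head (P.arc a)
    ... | yes ∋h = trans (headLoc-in S ∋h) (sym (headLoc-in T (S⊆T ∋h)))
    ... | no ∌h = trans (headLoc-out S ∌h) (sym (headLoc-out T
            (λ ∋h → either ∌h (kept-head (trans (P.head-loc a) (headLoc-out S ∌h)) k) (T⊆S+n ∋h))))

    module Premise (premise : ∀ n → Ordered (label n) → Arc)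
      (premiseP : ∀ p → Ordered (P.label p) → P.Arc) (premiseQ : ∀ p → Ordered (Q.label p) → Q.Arc)
      (P-loc : ∀ p o {x} o′ → P.loc p ≡ inj₁ x → P.arc (premiseP p o) ≡ premise x o′)
      (Q-loc : ∀ p o {x} o′ → Q.loc p ≡ inj₁ x → Q.arc (premiseQ p o) ≡ premise x o′) where

      premise-kept : ∀ m k o o′ → premiseQ (kept m k) o′ ≡ old (premiseP m o)
      premise-kept m k o o′ with x , eq , o″ ← ordered-loc RP m o =
        Q.arc-inj (trans (Q-loc (kept m k) o′ o″ (trans (kept-loc m k) eq))
          (trans (sym (P-loc m o o″ eq)) (sym (old-arc _))))

    extends : ∀ {l} → label n ≡ l → Extends P cs l q Q node
    extends lab = record
      { nodes = proj₁ nodes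
      ; arcs = proj₁ arcs
      ; new-node = Q.loc-inj (trans (proj₂ nodes (inj₂ (inj₁ tt))) (sym node-loc))
      ; label-kept = λ m k → trans (Q.label-loc _) (trans (cong labelLoc (kept-loc m k)) (sym (P.label-loc m)))
      ; label-n = trans (Q.label-loc node) (trans (cong labelLoc node-loc) lab)
      ; label-new• = λ i → trans (Q.label-loc _) (cong labelLoc (proj₂ nodes (inj₂ (inj₂ i))))
      ; tail-old = λ a → let k = inner-kept (P.tail-loc a) in k ,
          Q.loc-inj (trans (Q.tail-loc _) (trans (cong (inj₁ ∘ tail) (old-arc a))
            (trans (sym (P.tail-loc a)) (sym (kept-loc _ k)))))
      ; head-old = λ a k → Q.loc-inj (trans (Q.head-loc _) (trans (cong (headLoc T) (old-arc a))
          (trans (sym (head-kept a k)) (trans (sym (P.head-loc a)) (sym (kept-loc _ k))))))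
      ; head-cs = λ a a∈ → Q.loc-inj (trans (Q.head-loc _) (trans (cong (headLoc T) (old-arc a))
          (trans (headLoc-in T (subst (T ∋_) (sym (cs-sound a∈)) T∋n))
            (trans (cong inj₁ (cs-sound a∈)) (sym node-loc)))))
      ; tail-new = λ i → Q.loc-inj (trans (Q.tail-loc _) (trans (cong (inj₁ ∘ tail) (new-arc i))
          (trans (cong inj₁ (conc-tail i)) (sym node-loc))))
      ; head-new = λ i → Q.loc-inj (trans (Q.head-loc _) (trans (cong (headLoc T) (new-arc i))
          (trans (headLoc-out T (T∌conc i)) (sym (proj₂ nodes (inj₂ (inj₂ i)))))))
      ; left-kept = Premise.premise-kept left P.left Q.left P.left-loc Q.left-loc
      ; right-kept = Premise.premise-kept right P.right Q.right P.right-loc Q.right-loc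
      }

    premise-node : (premise : ∀ n → Ordered (label n) → Arc)
      (premiseQ : ∀ p → Ordered (Q.label p) → Q.Arc)
      (Q-loc : ∀ p o {x} o′ → Q.loc p ≡ inj₁ x → Q.arc (premiseQ p o) ≡ premise x o′) →
      ∀ {c} o′ → P.arc c ≡ premise n o′ → ∀ o → premiseQ node o ≡ old c
    premise-node premise premiseQ Q-loc o′ eq o =
      Q.arc-inj (trans (Q-loc node o o′ node-loc) (trans (sym eq) (sym (old-arc _))))

-- Derivations of subsets and the sequential proof-structures they yield.

module Sequents (R : ProofStructure) where
  open ProofStructure R
  open Incidence R
  open Restriction R
  open Composition R

  -- Membership conditions instead of an equation with a union: subsets are functions, whose
  -- equality would require extensionality. `Seq-resp` and the exchange of the two sets at a ⊗
  -- depend on this freedom.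
  record Adds (S : Subset) (n : Node) (T : Subset) : Set where
    field
      fresh : ¬ S ∋ n
      added : T ∋ n
      mono  : ∀ {x} → S ∋ x → T ∋ x
      only  : ∀ {x} → T ∋ x → S ∋ x ⊎ x ≡ n

  -- The subsets that can be built from axioms and 1 by adding nodes of R one by
  -- one in accordance with the clauses for sequential proof-structures.
  data Seq (T : Subset) : Set where
    leaf : ∀ n → label n ≡ ax ⊎ label n ≡ one → T ∋ n → (∀ {x} → T ∋ x → x ≡ n) → Seq T
    step : ∀ n S → label n ≡ bot ⊎ label n ≡ ⅋ → (∀ a → head a ≡ n → S ∋ tail a) →
           Seq S → Adds S n T → Seq T
    join : ∀ n p q S₁ S₂ → label n ≡ ⊗ ⊎ label n ≡ cut → head p ≡ n → head q ≡ n → p ≢ q →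
           S₁ ∋ tail p → S₂ ∋ tail q → (∀ x → S₁ ∋ x → ¬ S₂ ∋ x) →
           Seq S₁ → Seq S₂ → Adds (S₁ ∪ S₂) n T → Seq T

  join-premise : ∀ {n p q} → label n ≡ ⊗ ⊎ label n ≡ cut → head p ≡ n → head q ≡ n → p ≢ q →
                 ∀ a → head a ≡ n → a ≡ p ⊎ a ≡ q
  join-premise {n} {p} {q} (inj₁ lab) hp hq p≢q a ha = go (is p hp) (is q hq) (is a ha)
    where
    o : Ordered (label n)
    o = subst Ordered (sym lab) ⊗-ordered
    is : ∀ b → head b ≡ n → b ≡ left n o ⊎ b ≡ right n o
    is = ordered-premise o
    go : p ≡ left n o ⊎ p ≡ right n o → q ≡ left n o ⊎ q ≡ right n o →
         a ≡ left n o ⊎ a ≡ right n o → a ≡ p ⊎ a ≡ q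
    go (inj₁ x) (inj₁ y) _        = contradiction (trans x (sym y)) p≢q
    go (inj₂ x) (inj₂ y) _        = contradiction (trans x (sym y)) p≢q
    go (inj₁ x) (inj₂ y) (inj₁ z) = inj₁ (trans z (sym x))
    go (inj₁ x) (inj₂ y) (inj₂ z) = inj₂ (trans z (sym y))
    go (inj₂ x) (inj₁ y) (inj₁ z) = inj₂ (trans z (sym y))
    go (inj₂ x) (inj₁ y) (inj₂ z) = inj₁ (trans z (sym x))
  join-premise (inj₂ lab) hp hq p≢q a ha = cut-premise lab hp hq p≢q a ha

  Adds-upClosed : ∀ {S n T} → UpClosed S → (∀ a → head a ≡ n → S ∋ tail a) → Adds S n T → UpClosed T
  Adds-upClosed up prem A a ∋h with Adds.only A ∋h
  ... | inj₁ ∋h′ = Adds.mono A (up a ∋h′)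
  ... | inj₂ h≡n = Adds.mono A (prem a h≡n)

  join-premises : ∀ {n p q S₁ S₂} → label n ≡ ⊗ ⊎ label n ≡ cut → head p ≡ n → head q ≡ n → p ≢ q →
                  S₁ ∋ tail p → S₂ ∋ tail q → ∀ a → head a ≡ n → S₁ ∪ S₂ ∋ tail a
  join-premises {S₁ = S₁} {S₂} lab hp hq p≢q ∋p ∋q a ha with join-premise lab hp hq p≢q a ha
  ... | inj₁ refl = ∨-left ∋p
  ... | inj₂ refl = ∨-right {S₁ (tail a)} ∋q

  upClosed : ∀ {T} → Seq T → UpClosed T
  upClosed (leaf n (inj₁ lab) _ only) a ∋h = contradiction (only ∋h) (premiseless lab ax-premiseless a)
  upClosed (leaf n (inj₂ lab) _ only) a ∋h = contradiction (only ∋h) (premiseless lab one-premiseless a)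
  upClosed (step n S _ prem s A) = Adds-upClosed (upClosed s) prem A
  upClosed (join n p q S₁ S₂ lab hp hq p≢q ∋p ∋q disj s₁ s₂ A) =
    Adds-upClosed (∪-upClosed {S₁} {S₂} (upClosed s₁) (upClosed s₂))
      (join-premises {S₁ = S₁} {S₂} lab hp hq p≢q ∋p ∋q) A

  noBullet : ∀ {T} → Seq T → NoBullet T
  noBullet (leaf n lab _ only) x ∋x lab′ with refl ← only ∋x =
    either (λ e → contradiction (trans (sym lab′) e) λ ()) (λ e → contradiction (trans (sym lab′) e) λ ()) lab
  noBullet (step n S lab _ s A) x ∋x lab′ with Adds.only A ∋x
  ... | inj₁ ∋x′ = noBullet s x ∋x′ lab′
  ... | inj₂ refl =
    either (λ e → contradiction (trans (sym lab′) e) λ ()) (λ e → contradiction (trans (sym lab′) e) λ ()) lab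
  noBullet (join n p q S₁ S₂ lab hp hq p≢q ∋p ∋q disj s₁ s₂ A) x ∋x lab′ with Adds.only A ∋x
  ... | inj₁ ∋x′ = either (λ e → noBullet s₁ x e lab′) (λ e → noBullet s₂ x e lab′) (∨-split {S₁ x} ∋x′)
  ... | inj₂ refl =
    either (λ e → contradiction (trans (sym lab′) e) λ ()) (λ e → contradiction (trans (sym lab′) e) λ ()) lab

  boundary : ∀ {S Q} (RQ : Restricts S ⌊ Q ⌋) → ∀ c → ¬ S ∋ head (Restricts.arc RQ c) → IsConclusion Q c
  boundary {S} RQ c ∌h = trans (label-loc _) (cong labelLoc (trans (head-loc c) (headLoc-out S ∌h)))
    where open Restricts RQ

  none : Fin 0 → Arc
  none ()

  none-inj : Injective _≡_ _≡_ none
  none-inj {()}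

  Fin1-inj : ∀ {A : Set} (f : Fin 1 → A) → Injective _≡_ _≡_ f
  Fin1-inj f {zero} {zero} _ = refl

  -- Stated for every Q occupying the places of T, so that the induction hypothesis applies to the
  -- structures made by `Build` and the final instance to R itself.
  sequential : ∀ {T} → Seq T → ∀ Q → Restricts T ⌊ Q ⌋ → Sequential Q

  -- Induction hypotheses are passed as arguments because the lemma is applied with the two sets in
  -- either order. `ord` fixes p as left and q as right premise, except at a cut, whose premises are
  -- unordered.
  sequential-join : ∀ {T} n p q S₁ S₂ → label n ≡ cut ⊎ (Σ[ o ∈ Ordered (label n) ] p ≡ left n o × q ≡ right n o) →
    label n ≡ ⊗ ⊎ label n ≡ cut → head p ≡ n → head q ≡ n → p ≢ q →
    S₁ ∋ tail p → S₂ ∋ tail q → (∀ x → S₁ ∋ x → ¬ S₂ ∋ x) →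
    Seq S₁ → Seq S₂ → Adds (S₁ ∪ S₂) n T → ∀ Q → Restricts T ⌊ Q ⌋ →
    (∀ R₁ → Restricts S₁ ⌊ R₁ ⌋ → Sequential R₁) → (∀ R₂ → Restricts S₂ ⌊ R₂ ⌋ → Sequential R₂) → Sequential Q
  sequential-join {T} n p q S₁ S₂ ord lab hp hq p≢q ∋p ∋q disj s₁ s₂ A Q RQ seq₁ seq₂ = go ord lab
    where
    R₁ R₂ : ProofStructure
    R₁ = restriction S₁ (upClosed s₁) (noBullet s₁)
    R₂ = restriction S₂ (upClosed s₂) (noBullet s₂)
    RR₁ : Restricts S₁ ⌊ R₁ ⌋
    RR₁ = restricts S₁ (upClosed s₁) (noBullet s₁)
    RR₂ : Restricts S₂ ⌊ R₂ ⌋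
    RR₂ = restricts S₂ (upClosed s₂) (noBullet s₂)
    RP : Restricts (S₁ ∪ S₂) (⌊ R₁ ⌋ ⊕ ⌊ R₂ ⌋)
    RP = sum-restricts (upClosed s₁) (upClosed s₂) disj RR₁ RR₂
    module Q = ProofStructure Q
    module R₁ where
      open ProofStructure R₁ public
      open Restricts RR₁ public
    module R₂ where
      open ProofStructure R₂ public
      open Restricts RR₂ public
    module RQ = Restricts RQ
    open Adds A
    c₁ : R₁.Arc
    c₁ = proj₁ (R₁.arc-onto p ∋p)
    c₂ : R₂.Arc
    c₂ = proj₁ (R₂.arc-onto q ∋q)
    c₁-arc : R₁.arc c₁ ≡ p
    c₁-arc = proj₂ (R₁.arc-onto p ∋p)
    c₂-arc : R₂.arc c₂ ≡ q
    c₂-arc = proj₂ (R₂.arc-onto q ∋q)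
    concl₁ : IsConclusion R₁ c₁
    concl₁ = boundary {S₁} {R₁} RR₁ c₁
      (λ ∋h → fresh (∨-left (subst (S₁ ∋_) (trans (cong head c₁-arc) hp) ∋h)))
    concl₂ : IsConclusion R₂ c₂
    concl₂ = boundary {S₂} {R₂} RR₂ c₂
      (λ ∋h → fresh (∨-right {S₁ n} (subst (S₂ ∋_) (trans (cong head c₂-arc) hq) ∋h)))
    cs : List (R₁.Arc ⊎ R₂.Arc)
    cs = inj₁ c₁ ∷ inj₂ c₂ ∷ []
    cs-sound : ∀ {c} → c ∈ cs → head (Restricts.arc RP c) ≡ n
    cs-sound (here refl) = trans (cong head c₁-arc) hp
    cs-sound (there (here refl)) = trans (cong head c₂-arc) hq
    cs-complete : ∀ {c} → head (Restricts.arc RP c) ≡ n → c ∈ cs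
    cs-complete {c} h with join-premise lab hp hq p≢q (Restricts.arc RP c) h
    ... | inj₁ eq = here (Restricts.arc-inj RP (trans eq (sym c₁-arc)))
    ... | inj₂ eq = there (here (Restricts.arc-inj RP {c} {inj₂ c₂} (trans eq (sym c₂-arc))))

    module E = Extension RP RQ n fresh added mono only (∪-upClosed {S₁} {S₂} (upClosed s₁) (upClosed s₂))
      (join-premises {S₁ = S₁} {S₂} lab hp hq p≢q ∋p ∋q) cs cs-sound cs-complete

    go : label n ≡ cut ⊎ (Σ[ o ∈ Ordered (label n) ] p ≡ left n o × q ≡ right n o) →
         label n ≡ ⊗ ⊎ label n ≡ cut → Sequential Q
    go _ (inj₂ isCut) =
      E₀.node , cut-seq R₁ R₂ (seq₁ R₁ RR₁) (seq₂ R₂ RR₂) c₁ c₂ concl₁ concl₂ (E₀.extends isCut)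
      where
      module E₀ = E 0 none none-inj (λ ())
        (λ a h → contradiction h (conclusionless isCut cut-conclusionless a))
    go (inj₁ isCut) (inj₁ is⊗) = contradiction (trans (sym is⊗) isCut) λ ()
    go (inj₂ (o , refl , refl)) (inj₁ is⊗) =
      E₁.node , ⊗-seq R₁ R₂ (seq₁ R₁ RR₁) (seq₂ R₂ RR₂) c₁ c₂ concl₁ concl₂ (E₁.extends is⊗)
        (E₁.premise-node left Q.left RQ.left-loc {inj₁ c₁} o c₁-arc)
        (E₁.premise-node right Q.right RQ.right-loc {inj₂ c₂} o c₂-arc)
      where
      c : ∃ λ a → tail a ≡ n
      c = conclusion is⊗ ⊗-single
      module E₁ = E 1 (λ _ → proj₁ c) (Fin1-inj (λ _ → proj₁ c)) (λ _ → proj₂ c)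
        (λ a h → zero , conclusion-unique is⊗ ⊗-single (proj₂ c) h)

  sequential {T} (leaf n lab ∋n only) Q RQ = n′ , result lab
    where
    module Q = ProofStructure Q
    open Restricts RQ
    n′ : Q.Node
    n′ = proj₁ (loc-onto (inj₁ n) ∋n)
    n′-loc : loc n′ ≡ inj₁ n
    n′-loc = proj₂ (loc-onto (inj₁ n) ∋n)
    tails : ∀ a → Q.tail a ≡ n′
    tails a = loc-inj (trans (tail-loc a) (trans (cong inj₁ (only (arc-into a))) (sym n′-loc)))
    others : ∀ m → m ≡ n′ ⊎ (Q.label m ≡ • × ∃[ a ] Q.tail a ≡ n′ × Q.head a ≡ m)
    others m with loc m in eq | loc-into m
    ... | inj₁ x | ∋x = inj₁ (loc-inj (trans eq (trans (cong inj₁ (only ∋x)) (sym n′-loc))))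
    ... | inj₂ b | ∋t , ∌h with a , refl ← arc-onto b ∋t =
      inj₂ (trans (label-loc m) (cong labelLoc eq) , a , tails a ,
            loc-inj (trans (head-loc a) (trans (headLoc-out T ∌h) (sym eq))))
    result : label n ≡ ax ⊎ label n ≡ one → SequentialAt Q n′
    result (inj₁ isAx) = ax-seq (trans (label-loc n′) (trans (cong labelLoc n′-loc) isAx)) (tails , others)
    result (inj₂ isOne) = one-seq (trans (label-loc n′) (trans (cong labelLoc n′-loc) isOne)) (tails , others)
  sequential {T} (step n S lab prem s A) Q RQ = go lab
    where
    R₁ : ProofStructure
    R₁ = restriction S (upClosed s) (noBullet s)
    RR : Restricts S ⌊ R₁ ⌋
    RR = restricts S (upClosed s) (noBullet s)
    module Q = ProofStructure Q
    module RQ = Restricts RQ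
    open Restricts RR
    open Adds A
    module E = Extension RR RQ n fresh added mono only (upClosed s) prem
    go : label n ≡ bot ⊎ label n ≡ ⅋ → Sequential Q
    go (inj₁ isBot) = E₀.node , bot-seq R₁ (sequential s R₁ RR) (E₀.extends isBot)
      where
      c : ∃ λ a → tail a ≡ n
      c = conclusion isBot bot-single
      module E₀ = E [] (λ ()) (λ h → contradiction h (premiseless isBot bot-premiseless _))
        1 (λ _ → proj₁ c) (Fin1-inj (λ _ → proj₁ c)) (λ _ → proj₂ c)
        (λ a h → zero , conclusion-unique isBot bot-single (proj₂ c) h)
    go (inj₂ is⅋) = E₀.node , ⅋-seq R₁ (sequential s R₁ RR) c₁ c₂
        (concl c₁ c₁-arc (head-left n o)) (concl c₂ c₂-arc (head-right n o))
        (λ eq → left≢right n o (trans (sym c₁-arc) (trans (cong arc eq) c₂-arc)))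
        (E₀.extends is⅋)
        (E₀.premise-node left Q.left RQ.left-loc o c₁-arc)
        (E₀.premise-node right Q.right RQ.right-loc o c₂-arc)
      where
      o : Ordered (label n)
      o = subst Ordered (sym is⅋) ⅋-ordered
      c : ∃ λ a → tail a ≡ n
      c = conclusion is⅋ ⅋-single
      c₁ c₂ : ProofStructure.Arc R₁
      c₁ = proj₁ (arc-onto (left n o) (prem _ (head-left n o)))
      c₂ = proj₁ (arc-onto (right n o) (prem _ (head-right n o)))
      c₁-arc : arc c₁ ≡ left n o
      c₁-arc = proj₂ (arc-onto (left n o) (prem _ (head-left n o)))
      c₂-arc : arc c₂ ≡ right n o
      c₂-arc = proj₂ (arc-onto (right n o) (prem _ (head-right n o)))
      concl : ∀ c {a} → arc c ≡ a → head a ≡ n → IsConclusion R₁ c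
      concl c eq h = boundary {S} {R₁} RR c (λ ∋h → fresh (subst (S ∋_) (trans (cong head eq) h) ∋h))
      cs-sound : ∀ {c} → c ∈ c₁ ∷ c₂ ∷ [] → head (arc c) ≡ n
      cs-sound (here refl) = trans (cong head c₁-arc) (head-left n o)
      cs-sound (there (here refl)) = trans (cong head c₂-arc) (head-right n o)
      cs-complete : ∀ {c} → head (arc c) ≡ n → c ∈ c₁ ∷ c₂ ∷ []
      cs-complete {c} h with ordered-premise o (arc c) h
      ... | inj₁ eq = here (arc-inj (trans eq (sym c₁-arc)))
      ... | inj₂ eq = there (here (arc-inj (trans eq (sym c₂-arc))))
      module E₀ = E (c₁ ∷ c₂ ∷ []) cs-sound cs-complete
        1 (λ _ → proj₁ c) (Fin1-inj (λ _ → proj₁ c)) (λ _ → proj₂ c)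
        (λ a h → zero , conclusion-unique is⅋ ⅋-single (proj₂ c) h)
  sequential {T} (join n p q S₁ S₂ lab hp hq p≢q ∋p ∋q disj s₁ s₂ A) Q RQ = go lab
    where
    direct : label n ≡ cut ⊎ (Σ[ o ∈ Ordered (label n) ] p ≡ left n o × q ≡ right n o) → Sequential Q
    direct ord = sequential-join n p q S₁ S₂ ord lab hp hq p≢q ∋p ∋q disj s₁ s₂ A Q RQ (sequential s₁) (sequential s₂)
    -- `join` does not record which premise is the left one, while `⊗-seq` takes the left premise
    -- from its first structure; the sets may have to be exchanged.
    swapped : Adds (S₂ ∪ S₁) n T
    swapped = record
      { fresh = λ ∋n → Adds.fresh A (swap n ∋n)
      ; added = Adds.added A
      ; mono = λ {x} ∋x → Adds.mono A (swap x ∋x)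
      ; only = λ {x} ∋x → either (λ e → inj₁ (unswap x e)) inj₂ (Adds.only A ∋x)
      }
      where
      swap : ∀ x → S₂ ∪ S₁ ∋ x → S₁ ∪ S₂ ∋ x
      swap x e = either (∨-right {S₁ x}) ∨-left (∨-split {S₂ x} e)
      unswap : ∀ x → S₁ ∪ S₂ ∋ x → S₂ ∪ S₁ ∋ x
      unswap x e = either (∨-right {S₂ x}) ∨-left (∨-split {S₁ x} e)
    go : label n ≡ ⊗ ⊎ label n ≡ cut → Sequential Q
    go (inj₂ isCut) = direct (inj₁ isCut)
    go (inj₁ is⊗) = order (ordered-premise o p hp) (ordered-premise o q hq)
      where
      o : Ordered (label n)
      o = subst Ordered (sym is⊗) ⊗-ordered
      order : p ≡ left n o ⊎ p ≡ right n o → q ≡ left n o ⊎ q ≡ right n o → Sequential Q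
      order (inj₁ x) (inj₂ y) = direct (inj₂ (o , x , y))
      order (inj₂ x) (inj₁ y) =
        sequential-join n q p S₂ S₁ (inj₂ (o , y , x)) lab hq hp (p≢q ∘ sym) ∋q ∋p
          (λ x ∋x ∋x′ → disj x ∋x′ ∋x) s₂ s₁ swapped Q RQ (sequential s₂) (sequential s₁)
      order (inj₁ x) (inj₁ y) = contradiction (trans x (sym y)) p≢q
      order (inj₂ x) (inj₂ y) = contradiction (trans x (sym y)) p≢q

  nonBullet : Subset
  nonBullet x with •? (label x)
  ... | yes _ = false
  ... | no _  = true

  nonBullet-in : ∀ {x} → label x ≢ • → nonBullet ∋ x
  nonBullet-in {x} x≢ with •? (label x)
  ... | yes e = contradiction e x≢
  ... | no _ = refl

  nonBullet-out : ∀ {x} → nonBullet ∋ x → label x ≢ •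
  nonBullet-out {x} ∋x with •? (label x)
  ... | no e = e

  -- A • node has exactly one premise and can be identified with it, so R is its own restriction to
  -- the nodes other than •.
  restricts-R : Restricts nonBullet ⌊ R ⌋
  restricts-R = record
    { loc = λ x → loc x (•? (label x))
    ; arc = id
    ; loc-inj = λ {x} {y} → loc-inj x y (•? (label x)) (•? (label y))
    ; loc-into = λ x → loc-into x (•? (label x))
    ; loc-onto = loc-onto
    ; arc-inj = id
    ; arc-into = tails
    ; arc-onto = λ b _ → b , refl
    ; label-loc = λ x → label-loc x (•? (label x))
    ; tail-loc = λ a → loc-inner (tail≢• a) (•? (label (tail a)))
    ; head-loc = λ a → head-loc a (•? (label (head a)))
    ; left-loc = λ x → same left x (•? (label x))
    ; right-loc = λ x → same right x (•? (label x))
    }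
    where
    loc : ∀ x → Dec (label x ≡ •) → Node ⊎ Arc
    loc x (yes e) = inj₂ (proj₁ (•-premise e))
    loc x (no _)  = inj₁ x

    tail≢• : ∀ a → label (tail a) ≢ •
    tail≢• a e = conclusionless e •-conclusionless a refl

    tails : ∀ a → nonBullet ∋ tail a
    tails a = nonBullet-in (tail≢• a)

    loc-inner : ∀ {x} → label x ≢ • → ∀ d → loc x d ≡ inj₁ x
    loc-inner x≢ (yes e) = contradiction e x≢
    loc-inner x≢ (no _)  = refl

    loc-inj : ∀ x y d d′ → loc x d ≡ loc y d′ → x ≡ y
    loc-inj x y (yes e) (yes e′) eq =
      trans (sym (proj₂ (•-premise e))) (trans (cong head (inj₂-injective eq)) (proj₂ (•-premise e′)))
    loc-inj x y (no _) (no _) eq = inj₁-injective eq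

    loc-into : ∀ x d → Loc nonBullet (loc x d)
    loc-into x (yes e) = tails _ , λ ∋h → nonBullet-out ∋h (trans (cong label (proj₂ (•-premise e))) e)
    loc-into x (no ¬e) = nonBullet-in ¬e

    loc-outer : ∀ a d → label (head a) ≡ • → loc (head a) d ≡ inj₂ a
    loc-outer a (yes e) _ = cong inj₂ (•-premise-unique e (proj₂ (•-premise e)) refl)
    loc-outer a (no ¬e) e = contradiction e ¬e

    head-loc : ∀ a d → loc (head a) d ≡ headLoc nonBullet a
    head-loc a (yes e) = trans (loc-outer a (yes e) e)
      (sym (headLoc-out nonBullet (λ ∋h → nonBullet-out ∋h e)))
    head-loc a (no ¬e) = sym (headLoc-in nonBullet (nonBullet-in ¬e))

    loc-onto : ∀ l → Loc nonBullet l → ∃ λ x → loc x (•? (label x)) ≡ l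
    loc-onto (inj₁ x) ∋x = x , loc-inner (nonBullet-out ∋x) _
    loc-onto (inj₂ a) (_ , ∌h) = head a , loc-outer a _ (boundary-• (•? (label (head a))))
      where
      boundary-• : Dec (label (head a) ≡ •) → label (head a) ≡ •
      boundary-• (yes e) = e
      boundary-• (no ¬e) = contradiction (nonBullet-in ¬e) ∌h

    label-loc : ∀ x d → label x ≡ labelLoc (loc x d)
    label-loc x (yes e) = e
    label-loc x (no _) = refl

    same : ∀ (premise : ∀ n → Ordered (label n) → Arc) x d o {y} o′ → loc x d ≡ inj₁ y → premise x o ≡ premise y o′
    same premise x (no _) o o′ refl = cong (premise x) (Ordered-irrelevant o o′)

-- Undirected walks and cycles.

module Walks (G : Graph) where
  open Graph G

  -- Walks that carry a property of their arcs, typically that they stay inside a set or that they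
  -- avoid a given arc.
  data Via (P : Arc → Set) : Node → Node → Set where
    stop  : ∀ {x} → Via P x x
    along : ∀ {x y} a → tail a ≡ x → P a → Via P (head a) y → Via P x y
    back  : ∀ {x y} a → head a ≡ x → P a → Via P (tail a) y → Via P x y

  module _ {P : Arc → Set} where

    infixr 5 _⊙_

    _⊙_ : ∀ {x y z} → Via P x y → Via P y z → Via P x z
    stop ⊙ w = w
    along a eq p v ⊙ w = along a eq p (v ⊙ w)
    back a eq p v ⊙ w = back a eq p (v ⊙ w)

    reverse : ∀ {x y} → Via P x y → Via P y x
    reverse stop = stop
    reverse (along a refl p w) = reverse w ⊙ back a refl p stop
    reverse (back a refl p w) = reverse w ⊙ along a refl p stop

    weaken : ∀ {Q : Arc → Set} → (∀ {a} → P a → Q a) → ∀ {x y} → Via P x y → Via Q x y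
    weaken f stop = stop
    weaken f (along a eq p w) = along a eq (f p) (weaken f w)
    weaken f (back a eq p w) = back a eq (f p) (weaken f w)

    connected : ∀ {x y} → Via P x y → Connected x y
    connected stop = ε
    connected (along a refl _ w) = fwd (a , refl , refl) ◅ connected w
    connected (back a refl _ w) = bwd (a , refl , refl) ◅ connected w

    arcs-connected : ∀ {x y} (w : Via P x y) {a} → a ∈ arcsOf (connected w) → P a
    arcs-connected (along a refl p w) (here refl) = p
    arcs-connected (along a refl p w) (there a∈) = arcs-connected w a∈
    arcs-connected (back a refl p w) (here refl) = p
    arcs-connected (back a refl p w) (there a∈) = arcs-connected w a∈

  endpoint : ∀ {x z} (s : SymClosure Link x z) → x ≡ tail (arcOf s) ⊎ x ≡ head (arcOf s)
  endpoint (fwd (_ , eq , _)) = inj₁ (sym eq)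
  endpoint (bwd (_ , _ , eq)) = inj₂ (sym eq)

  start-visited : ∀ {z y} (w : Connected z y) → z ∈ y ∷ nodesOf w
  start-visited ε = here refl
  start-visited (_ ◅ _) = there (here refl)

  later : ∀ {A : Set} {y x n : A} {xs} → n ∈ y ∷ xs → n ∈ y ∷ x ∷ xs
  later (here eq) = here eq
  later (there n∈) = there (there n∈)

  endpoints-visited : ∀ {z y} (w : Connected z y) {e} → e ∈ arcsOf w →
                      tail e ∈ y ∷ nodesOf w × head e ∈ y ∷ nodesOf w
  endpoints-visited (fwd (e , refl , refl) ◅ w) (here refl) = there (here refl) , later (start-visited w)
  endpoints-visited (bwd (e , refl , refl) ◅ w) (here refl) = later (start-visited w) , there (here refl)
  endpoints-visited (_ ◅ w) (there e∈) with t , h ← endpoints-visited w e∈ = later t , later h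

  -- `nodesOf` omits the endpoint. Putting it in front makes this the node list of the closed walk
  -- that `cycle` forms by prefixing an arc from y to x.
  Simple : ∀ {x y} → Connected x y → Set
  Simple {y = y} w = Unique (y ∷ nodesOf w)

  swap-head : ∀ {A : Set} {y x : A} {xs} → x ∉ y ∷ xs → Unique (y ∷ xs) → Unique (y ∷ x ∷ xs)
  swap-head {A} {y} {x} x∉ (y∉ ∷ u) = ((λ y≡x → x∉ (here (sym y≡x))) ∷ y∉) ∷ fresh _ (x∉ ∘ there) ∷ u
    where
    fresh : ∀ xs → x ∉ xs → All (x ≢_) xs
    fresh [] _ = []
    fresh (z ∷ zs) x∉zs = (λ eq → x∉zs (here eq)) ∷ fresh zs (x∉zs ∘ there)

  drop-second : ∀ {A : Set} {y x : A} {xs} → Unique (y ∷ x ∷ xs) → x ∉ y ∷ xs × Unique (y ∷ xs)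
  drop-second ((y≢x ∷ y∉) ∷ x∉ ∷ u) =
    (λ { (here x≡y) → y≢x (sym x≡y) ; (there x∈) → All.lookup x∉ x∈ refl }) , y∉ ∷ u

  -- If the first arc occurred again, the rest of the walk would visit both its ends, among them the
  -- starting node x.
  simple-arcs : ∀ {x y} (w : Connected x y) → Simple w → Unique (arcsOf w)
  simple-arcs ε _ = []
  simple-arcs {x} (s ◅ w) u with x∉ , u′ ← drop-second u =
    All.tabulate (λ {e} e∈ eq → x∉ (x-visited e e∈ eq)) ∷ simple-arcs w u′
    where
    x-visited : ∀ e → e ∈ arcsOf w → arcOf s ≡ e → x ∈ _ ∷ nodesOf w
    x-visited e e∈ refl with endpoint s | endpoints-visited w e∈
    ... | inj₁ eq | t , _ = subst (_∈ _) (sym eq) t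
    ... | inj₂ eq | _ , h = subst (_∈ _) (sym eq) h

  suffix : ∀ {x y z} (w : Connected z y) → Simple w → x ∈ y ∷ nodesOf w →
           Σ[ w′ ∈ Connected x y ] (Simple w′ × (∀ {e} → e ∈ arcsOf w′ → e ∈ arcsOf w))
  suffix w u (here refl) = ε , ([] ∷ []) , λ ()
  suffix (s ◅ w) u (there (here refl)) = s ◅ w , u , id
  suffix (s ◅ w) u (there (there x∈))
    with w′ , u′ , sub ← suffix w (proj₂ (drop-second u)) (there x∈) = w′ , u′ , there ∘ sub

  module _ (_≟ⁿ_ : DecidableEquality Node) where
    open import Data.List.Membership.DecPropositional _≟ⁿ_ using (_∈?_)

    -- The rest of the walk is made simple; if it still visits x, its part from x on replaces the
    -- whole. No arc is ever introduced, so avoiding an arc is preserved.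
    loop-erase : ∀ {x y} (w : Connected x y) →
                 Σ[ w′ ∈ Connected x y ] (Simple w′ × (∀ {e} → e ∈ arcsOf w′ → e ∈ arcsOf w))
    loop-erase ε = ε , ([] ∷ []) , id
    loop-erase {x} {y} (s ◅ w) with w′ , u , sub ← loop-erase w with x ∈? y ∷ nodesOf w′
    ... | yes x∈ with w″ , u′ , sub′ ← suffix w′ u x∈ = w″ , u′ , there ∘ sub ∘ sub′
    ... | no x∉ = s ◅ w′ , swap-head x∉ u , λ { (here eq) → here eq ; (there e∈) → there (sub e∈) }

    -- Loop erasure leaves a simple walk that still avoids `a`, so prefixing `a` keeps both arcs and
    -- nodes distinct.
    cycle : ∀ a → Via (_≢ a) (head a) (tail a) → Cycle
    cycle a w with w′ , u , sub ← loop-erase (connected w) = record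
      { walk = fwd (a , refl , refl) ◅ w′
      ; nonEmpty = λ ()
      ; distinct-arcs = All.tabulate (λ {e} e∈ eq → arcs-connected w (sub e∈) (sym eq)) ∷ simple-arcs w′ u
      ; distinct-nodes = u
      }

-- Erasing nodes and switchings that prefer live premises.

module Erasure (R : ProofStructure) where
  open ProofStructure R
  open Incidence R

  private
    _≺_ : Node → Node → Set
    _≺_ = TransClosure Link

    ≺-wellFounded : WellFounded _≺_
    ≺-wellFounded = spo-wellFounded {_≈_ = _≡_} {_⊏_ = _≺_} record
      { isEquivalence = isEquivalence
      ; irrefl = λ { refl x≺x → acyclic (_ , x≺x) }
      ; trans = _++⁺_
      ; <-resp-≈ = (λ { refl → id }) , λ { refl → id }
      }

    Weak : Label → Set
    Weak l = l ≡ bot ⊎ l ≡ ⅋ ⊎ l ≡ •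

    weak? : ∀ l → Dec (Weak l)
    weak? l = bot? l ⊎-dec ⅋? l ⊎-dec •? l

    -- A finite acyclic graph makes the passage from a node to the tails of its premises
    -- well-founded, so the inductive predicate is decided by recursion on accessibility.
    erasing-acc : ∀ n → Acc _≺_ n → Dec (Erasing R n)
    erasing-acc n (acc rs) with weak? (label n) | all? premise
      where
      premise : ∀ a → Dec (head a ≡ n → Erasing R (tail a))
      premise a with head a ≟ n
      ... | no h≢n = yes (λ h≡n → contradiction h≡n h≢n)
      ... | yes h≡n with erasing-acc (tail a) (rs [ a , refl , h≡n ])
      ...   | yes e = yes (const e)
      ...   | no ¬e = no (λ f → ¬e (f h≡n))
    ... | yes w | yes ps = yes (erasing w ps)
    ... | no ¬w | _      = no λ { (erasing w _) → ¬w w }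
    ... | yes _ | no ¬ps = no λ { (erasing _ ps) → ¬ps ps }

  erasing? : ∀ n → Dec (Erasing R n)
  erasing? n = erasing-acc n (≺-wellFounded n)

  -- `Core` is the notion that the overview calls live. `Live` alone also holds of a • node below a
  -- node that is not erasing.
  Live Core : Node → Set
  Live n = ¬ Erasing R n
  Core n = Live n × label n ≢ •

  core? : ∀ n → Dec (Core n)
  core? n = ¬? (erasing? n) ×-dec ¬? (•? (label n))

  erasing-premise : ∀ {a n} → Erasing R n → head a ≡ n → Erasing R (tail a)
  erasing-premise (erasing _ ps) = ps _

  bot-erasing : ∀ {n} → label n ≡ bot → Erasing R n
  bot-erasing eq = erasing (inj₁ eq) λ a h → contradiction h (premiseless eq bot-premiseless a)

  data Joining : Label → Set where
    ⊗-joining   : Joining ⊗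
    cut-joining : Joining cut

  joining? : ∀ l → Dec (Joining l)
  joining? ax  = no λ ()
  joining? cut = yes cut-joining
  joining? one = no λ ()
  joining? bot = no λ ()
  joining? ⊗   = yes ⊗-joining
  joining? ⅋   = no λ ()
  joining? •   = no λ ()

  joining-live : ∀ {n} → Joining (label n) → Live n
  joining-live {n} j (erasing w _) with label n
  joining-live ⊗-joining (erasing (inj₁ ()) _) | _
  joining-live ⊗-joining (erasing (inj₂ (inj₁ ())) _) | _
  joining-live ⊗-joining (erasing (inj₂ (inj₂ ())) _) | _
  joining-live cut-joining (erasing (inj₁ ()) _) | _
  joining-live cut-joining (erasing (inj₂ (inj₁ ())) _) | _
  joining-live cut-joining (erasing (inj₂ (inj₂ ())) _) | _

  joining≢• : ∀ {n} → Joining (label n) → label n ≢ •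
  joining≢• j eq with () ← subst Joining eq j

  joining≢⅋ : ∀ {n} → Joining (label n) → label n ≢ ⅋
  joining≢⅋ j eq with () ← subst Joining eq j

  joining-label : ∀ {n} → Joining (label n) → label n ≡ ⊗ ⊎ label n ≡ cut
  joining-label {n} j = go refl j
    where
    go : ∀ {l} → label n ≡ l → Joining l → label n ≡ ⊗ ⊎ label n ≡ cut
    go eq ⊗-joining = inj₁ eq
    go eq cut-joining = inj₂ eq

  tail≢• : ∀ a → label (tail a) ≢ •
  tail≢• a e = conclusionless e •-conclusionless a refl

  ⅋-ordered-at : ∀ {n} → label n ≡ ⅋ → Ordered (label n)
  ⅋-ordered-at eq = subst Ordered (sym eq) ⅋-ordered

  Good : Switching R → Set
  Good φ = ∀ n p → Erasing R (tail (Switching.choice φ n p)) → Erasing R n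

  -- A switching that avoids erasing premises and, after that, the arcs in
  -- `avoid`, as far as possible.
  module Preference {Avoid : Arc → Set} (avoid? : ∀ a → Dec (Avoid a)) where

    select : ∀ l r → Dec (Erasing R (tail l)) → Dec (Erasing R (tail r)) → Dec (Avoid l) → Arc
    select l r (yes _) _ _ = r
    select l r (no _) (yes _) _ = l
    select l r (no _) (no _) (yes _) = r
    select l r (no _) (no _) (no _) = l

    select-either : ∀ l r d d′ d″ → select l r d d′ d″ ≡ l ⊎ select l r d d′ d″ ≡ r
    select-either l r (yes _) _ _ = inj₂ refl
    select-either l r (no _) (yes _) _ = inj₁ refl
    select-either l r (no _) (no _) (yes _) = inj₂ refl
    select-either l r (no _) (no _) (no _) = inj₁ refl

    select-erasing : ∀ l r d d′ d″ → Erasing R (tail (select l r d d′ d″)) →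
                     Erasing R (tail l) × Erasing R (tail r)
    select-erasing l r (yes e) _ _ e′ = e , e′
    select-erasing l r (no ¬e) (yes _) _ e′ = contradiction e′ ¬e
    select-erasing l r (no _) (no ¬e) (yes _) e′ = contradiction e′ ¬e
    select-erasing l r (no ¬e) (no _) (no _) e′ = contradiction e′ ¬e

    select-avoid : ∀ l r d d′ d″ → Avoid (select l r d d′ d″) →
                   (Erasing R (tail l) ⊎ Avoid l) × (Erasing R (tail r) ⊎ Avoid r)
    select-avoid l r (yes e) _ _ v = inj₁ e , inj₂ v
    select-avoid l r (no _) (yes e) _ v = inj₂ v , inj₁ e
    select-avoid l r (no _) (no _) (yes v′) v = inj₂ v′ , inj₂ v
    select-avoid l r (no _) (no _) (no ¬v) v = contradiction v ¬v

    select-at : ∀ n → label n ≡ ⅋ → Arc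
    select-at n p = select (left n o) (right n o) (erasing? _) (erasing? _) (avoid? _)
      where o = ⅋-ordered-at p

    switching : Switching R
    switching = record { choice = select-at ; choice-premise = premise }
      where
      premise : ∀ n p → head (select-at n p) ≡ n
      premise n p = let o = ⅋-ordered-at p in
        either′ (λ eq → trans (cong head eq) (head-left n o)) (λ eq → trans (cong head eq) (head-right n o))
          (select-either (left n o) (right n o) (erasing? _) (erasing? _) (avoid? _))

    good : Good switching
    good n p e = erasing (inj₂ (inj₁ p)) premises-erasing
      where
      o : Ordered (label n)
      o = ⅋-ordered-at p
      both : Erasing R (tail (left n o)) × Erasing R (tail (right n o))
      both = select-erasing (left n o) (right n o) (erasing? _) (erasing? _) (avoid? _) e
      premises-erasing : ∀ a → head a ≡ n → Erasing R (tail a)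
      premises-erasing a h with ordered-premise o a h
      ... | inj₁ eq = subst (Erasing R ∘ tail) (sym eq) (proj₁ both)
      ... | inj₂ eq = subst (Erasing R ∘ tail) (sym eq) (proj₂ both)

    avoided : ∀ n p → Avoid (Switching.choice switching n p) →
              ∀ a → head a ≡ n → Erasing R (tail a) ⊎ Avoid a
    avoided n p v a h with ordered-premise o a h
      where o = ⅋-ordered-at p
    ... | inj₁ refl = proj₁ (select-avoid _ _ (erasing? _) (erasing? _) (avoid? _) v)
    ... | inj₂ refl = proj₂ (select-avoid _ _ (erasing? _) (erasing? _) (avoid? _) v)

  module Switched (φ : Switching R) where
    open Switching φ

    headᵠ : Arc → Node ⊎ (∃[ n ] label n ≡ ⅋)
    headᵠ = Graph.head (switchingGraph R φ)

    headᵠ-plain : ∀ {a} → label (head a) ≢ ⅋ → headᵠ a ≡ inj₁ (head a)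
    headᵠ-plain {a} ≢⅋ with ⅋? (label (head a))
    ... | no _  = refl
    ... | yes p = contradiction p ≢⅋

    -- `switchedHead` consults `choice` at the label proof returned by `⅋?`; uniqueness of equality
    -- proofs identifies it with `p`.
    headᵠ-chosen : ∀ n p → headᵠ (choice n p) ≡ inj₁ n
    headᵠ-chosen n p with ⅋? (label (head (choice n p)))
    ... | no ≢⅋ = cong inj₁ (choice-premise n p)
    ... | yes p′ with choice n p ≟ choice (head (choice n p)) p′
    ...   | yes _ = cong inj₁ (choice-premise n p)
    ...   | no ≢choice = contradiction (same (choice-premise n p) p′) ≢choice
      where
      same : ∀ {m} → m ≡ n → (p′ : label m ≡ ⅋) → choice n p ≡ choice m p′
      same refl p′ = cong (choice n) (≡-irrelevant p p′)

    headᵠ-unchosen : ∀ {a} n p → head a ≡ n → a ≢ choice n p → headᵠ a ≡ inj₂ (n , p)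
    headᵠ-unchosen {a} n p refl a≢ with ⅋? (label (head a))
    ... | no ≢⅋ = contradiction p ≢⅋
    ... | yes p′ with ≡-irrelevant p p′
    ...   | refl with a ≟ choice (head a) p
    ...     | yes eq = contradiction eq a≢
    ...     | no _ = refl

-- Weakening and connectedness within a derived set.

module Partial (R : ProofStructure) (ok : [¬w⊗] R) where
  open ProofStructure R
  open Incidence R
  open Restriction R
  open Composition R
  open Sequents R
  open Erasure R

  joining-premise-live : ∀ {a} → Joining (label (head a)) → Live (tail a)
  joining-premise-live {a} j = ok a (either′ inj₂ inj₁ (joining-label j))

  joining-premises : ∀ {n} → Joining (label n) → ∃ λ p → ∃ λ q → head p ≡ n × head q ≡ n × p ≢ q
  joining-premises {n} j with joining-label j
  ... | inj₁ is⊗ = left n o , right n o , head-left n o , head-right n o , left≢right n o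
    where o = subst Ordered (sym is⊗) ⊗-ordered
  ... | inj₂ isCut = cut-premises isCut

  single : Node → Subset
  single n x = does (x ≟ n)

  ∋-single : ∀ n → single n ∋ n
  ∋-single n with n ≟ n
  ... | yes _ = refl
  ... | no n≢n = contradiction refl n≢n

  single-∋ : ∀ {n x} → single n ∋ x → x ≡ n
  single-∋ {n} {x} ∋x with x ≟ n
  ... | yes eq = eq

  adds : ∀ {S n} → ¬ S ∋ n → Adds S n (S ∪ single n)
  adds {S} {n} ∌n = record
    { fresh = ∌n
    ; added = ∨-right {S n} (∋-single n)
    ; mono = ∨-left
    ; only = λ {x} ∋x → either′ inj₁ (inj₂ ∘ single-∋) (∨-split {S x} ∋x)
    }

  infix 4 _⊆_

  _⊆_ : Subset → Subset → Set
  S ⊆ T = ∀ {x} → S ∋ x → T ∋ x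

  -- Paths of erasing nodes leading to n, whose nodes after the first lie in T.
  data Lead (T : Subset) (n : Node) : Node → Set where
    last : ∀ {x} a → tail a ≡ x → Erasing R x → head a ≡ n → Lead T n x
    more : ∀ {x} a → tail a ≡ x → Erasing R x → T ∋ head a → Lead T n (head a) → Lead T n x

  lead-erasing : ∀ {T n x} → Lead T n x → Erasing R x
  lead-erasing (last _ _ e _) = e
  lead-erasing (more _ _ e _ _) = e

  lead-mono : ∀ {T T′ n x} → T ⊆ T′ → Lead T n x → Lead T′ n x
  lead-mono sub (last a t e h) = last a t e h
  lead-mono sub (more a t e ∋h l) = more a t e (sub ∋h) (lead-mono sub l)

  lead-trans : ∀ {T n m x} → T ∋ m → Lead T n m → Lead T m x → Lead T n x
  lead-trans ∋m l (last a t e refl) = more a t e ∋m l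
  lead-trans ∋m l (more a t e ∋h l′) = more a t e ∋h (lead-trans ∋m l l′)

  -- The leads serve the invariants of a `State`: through them `lead-undone` shows that the added
  -- nodes belonged to no class, and `settled-lead` that their conclusions point back into the set.
  record Enlargement (S : Subset) (n : Node) : Set where
    field
      set  : Subset
      seq  : Seq set
      mono : S ⊆ set
      only : ∀ {x} → set ∋ x → S ∋ x ⊎ Lead set n x

  open Enlargement

  unchanged : ∀ {S n} → Seq S → Enlargement S n
  unchanged {S} s = record { set = S ; seq = s ; mono = id ; only = inj₁ }

  enlarge-trans : ∀ {S n} (E : Enlargement S n) → Enlargement (set E) n → Enlargement S n
  enlarge-trans E F = record
    { set = set F ; seq = seq F ; mono = mono F ∘ mono E
    ; only = λ ∋x → either′ (λ ∋x′ → either′ inj₁ (inj₂ ∘ lead-mono (mono F)) (only E ∋x′)) inj₂ (only F ∋x)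
    }

  -- Recursion on the proof that the tail is erasing: a ⊥ is added by weakening, a ⅋ after both its
  -- premises, and a • is never the tail of an arc.
  enlarge-arc : ∀ {S n} a → head a ≡ n → Erasing R (tail a) → Seq S → Σ[ E ∈ Enlargement S n ] set E ∋ tail a
  enlarge-arc {S} a h e s with S ∋? tail a
  enlarge-arc {S} a h e s | yes ∋t = unchanged s , ∋t
  enlarge-arc {S} {n} a h e@(erasing (inj₁ isBot) ps) s | no ∌t = record
    { set = S ∪ single (tail a)
    ; seq = step (tail a) S (inj₁ isBot) (λ b hb → contradiction hb (premiseless isBot bot-premiseless b)) s A
    ; mono = Adds.mono A
    ; only = λ ∋x → either′ inj₁ (λ x≡t → inj₂ (last a (sym x≡t) (subst (Erasing R) (sym x≡t) e) h)) (Adds.only A ∋x)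
    } , Adds.added A
    where
    A : Adds S (tail a) (S ∪ single (tail a))
    A = adds ∌t
  enlarge-arc {S} {n} a h e@(erasing (inj₂ (inj₁ is⅋)) ps) s | no _ = go (set E ∋? tail a)
    where
    o : Ordered (label (tail a))
    o = ⅋-ordered-at is⅋
    l r : Arc
    l = left (tail a) o
    r = right (tail a) o
    E₁ : Σ[ E ∈ Enlargement S (tail a) ] set E ∋ tail l
    E₁ = enlarge-arc l (head-left _ o) (ps l (head-left _ o)) s
    E₂ : Σ[ E ∈ Enlargement (set (proj₁ E₁)) (tail a) ] set E ∋ tail r
    E₂ = enlarge-arc r (head-right _ o) (ps r (head-right _ o)) (seq (proj₁ E₁))
    E : Enlargement S (tail a)
    E = enlarge-trans (proj₁ E₁) (proj₁ E₂)
    premises∈ : ∀ b → head b ≡ tail a → set E ∋ tail b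
    premises∈ b hb with ordered-premise o b hb
    ... | inj₁ refl = mono (proj₁ E₂) (proj₂ E₁)
    ... | inj₂ refl = proj₂ E₂
    -- Deciding membership once more replaces an acyclicity argument that enlarging above `tail a`
    -- cannot add `tail a` itself.
    go : Dec (set E ∋ tail a) → Σ[ F ∈ Enlargement S n ] set F ∋ tail a
    go (yes ∋t) = record
      { set = set E ; seq = seq E ; mono = mono E
      ; only = λ ∋x → either′ inj₁ (inj₂ ∘ lead-trans ∋t (last a refl e h)) (only E ∋x)
      } , ∋t
    go (no ∌t) = record
      { set = set E ∪ single (tail a)
      ; seq = step (tail a) (set E) (inj₂ is⅋) premises∈ (seq E) A
      ; mono = Adds.mono A ∘ mono E
      ; only = λ ∋x → either′
          (λ ∋x′ → either′ inj₁ (inj₂ ∘ lead-trans (Adds.added A) (last a refl e h) ∘ lead-mono (Adds.mono A)) (only E ∋x′))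
          (λ x≡t → inj₂ (last a (sym x≡t) (subst (Erasing R) (sym x≡t) e) h)) (Adds.only A ∋x)
      } , Adds.added A
      where
      A : Adds (set E) (tail a) (set E ∪ single (tail a))
      A = adds ∌t
  enlarge-arc a h (erasing (inj₂ (inj₂ is•)) ps) s | no _ = contradiction is• (tail≢• a)

  module _ (φ : Switching R) (good : Good φ) where
    open Switching φ
    open Switched φ
    open Walks (switchingGraph R φ)

    Inside : Subset → Arc → Set
    Inside T a = T ∋ tail a × T ∋ head a

    -- Only live nodes are covered, since an erasing premise discarded by the switching ends at a
    -- fresh • node. A live ⅋ is linked to its chosen premise, which is live because `φ` is good.
    -- The premises of a ⊗ or cut are live by `ok`, so all live nodes of both parts reach the new
    -- node.
    inside-connected : ∀ {T} → Seq T → ∀ {x y} → T ∋ x → T ∋ y → Live x → Live y →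
                       Via (Inside T) (inj₁ x) (inj₁ y)
    inside-connected (leaf n _ _ unique) ∋x ∋y _ _ with refl ← unique ∋x | refl ← unique ∋y = stop
    inside-connected {T} (step n S lab prem s A) {x} {y} ∋x ∋y lx ly =
      let x′ , ∋x′ , lx′ , v = hub x ∋x lx
          y′ , ∋y′ , ly′ , w = hub y ∋y ly
      in v ⊙ weaken inside (inside-connected s ∋x′ ∋y′ lx′ ly′) ⊙ reverse w
      where
      inside : ∀ {a} → Inside S a → Inside T a
      inside (t , h) = Adds.mono A t , Adds.mono A h
      hub : ∀ z → T ∋ z → Live z → ∃ λ z′ → S ∋ z′ × Live z′ × Via (Inside T) (inj₁ z) (inj₁ z′)
      hub z ∋z lz with Adds.only A ∋z
      ... | inj₁ ∋z′ = z , ∋z′ , lz , stop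
      ... | inj₂ refl = either′ (λ isBot → contradiction (bot-erasing isBot) lz) from-⅋ lab
        where
        from-⅋ : label z ≡ ⅋ → ∃ λ z′ → S ∋ z′ × Live z′ × Via (Inside T) (inj₁ z) (inj₁ z′)
        from-⅋ is⅋ = tail c , ∋c , lz ∘ good z is⅋ ,
            back c (headᵠ-chosen z is⅋) (Adds.mono A ∋c , subst (T ∋_) (sym hc) ∋z) stop
          where
          c : Arc
          c = choice z is⅋
          hc : head c ≡ z
          hc = choice-premise z is⅋
          ∋c : S ∋ tail c
          ∋c = prem c hc
    inside-connected {T} (join n p q S₁ S₂ lab hp hq p≢q ∋p ∋q disj s₁ s₂ A) {x} {y} ∋x ∋y lx ly =
      to-n x ∋x lx ⊙ reverse (to-n y ∋y ly)
      where
      joining : Joining (label n)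
      joining = either′ (λ e → subst Joining (sym e) ⊗-joining) (λ e → subst Joining (sym e) cut-joining) lab
      premise-live : ∀ {a} → head a ≡ n → Live (tail a)
      premise-live refl = joining-premise-live joining
      down : ∀ {S a} → S ⊆ T → head a ≡ n → S ∋ tail a → Via (Inside T) (inj₁ (tail a)) (inj₁ n)
      down {S} {a} sub refl ∋t = along a refl (sub ∋t , Adds.added A)
        (subst (λ z → Via (Inside T) z (inj₁ n)) (sym (headᵠ-plain (joining≢⅋ joining))) stop)
      sub₁ : S₁ ⊆ T
      sub₁ = Adds.mono A ∘ ∨-left
      sub₂ : S₂ ⊆ T
      sub₂ {z} = Adds.mono A ∘ ∨-right {S₁ z}
      to-n : ∀ z → T ∋ z → Live z → Via (Inside T) (inj₁ z) (inj₁ n)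
      to-n z ∋z lz with Adds.only A ∋z
      ... | inj₂ refl = stop
      ... | inj₁ ∋z′ with ∨-split {S₁ z} ∋z′
      ...   | inj₁ ∋₁ = weaken (λ (t , h) → sub₁ t , sub₁ h) (inside-connected s₁ ∋₁ ∋p lz (premise-live hp))
                        ⊙ down sub₁ hp ∋p
      ...   | inj₂ ∋₂ = weaken (λ (t , h) → sub₂ t , sub₂ h) (inside-connected s₂ ∋₂ ∋q lz (premise-live hq))
                        ⊙ down sub₂ hq ∋q

-- Contraction until no step is possible.

module _ {A : Set} {P Q : A → Set} (P? : Decidable P) (Q? : Decidable Q) (P⇒Q : ∀ {x} → P x → Q x) where

  filter-mono : ∀ xs → length (filter P? xs) ≤ length (filter Q? xs)
  filter-mono [] = z≤n
  filter-mono (x ∷ xs) with P? x | Q? x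
  ... | yes _ | yes _ = s≤s (filter-mono xs)
  ... | yes p | no ¬q = contradiction (P⇒Q p) ¬q
  ... | no _  | yes _ = m≤n⇒m≤1+n (filter-mono xs)
  ... | no _  | no _  = filter-mono xs

  filter-strict : ∀ {x xs} → x ∈ xs → ¬ P x → Q x → length (filter P? xs) < length (filter Q? xs)
  filter-strict {x} {_ ∷ xs} (here refl) ¬p q with P? x | Q? x
  ... | yes p | _     = contradiction p ¬p
  ... | no _  | yes _ = s≤s (filter-mono xs)
  ... | no _  | no ¬q = contradiction q ¬q
  filter-strict {x} {y ∷ xs} (there x∈) ¬p q with P? y | Q? y
  ... | yes _ | yes _ = s≤s (filter-strict x∈ ¬p q)
  ... | yes p | no ¬q = contradiction (P⇒Q p) ¬q
  ... | no _  | yes _ = m≤n⇒m≤1+n (filter-strict x∈ ¬p q)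
  ... | no _  | no _  = filter-strict x∈ ¬p q

module Contraction (R : ProofStructure) (ok : [¬w⊗] R)
                   (no-cycle : ∀ φ → ¬ Graph.Cycle (switchingGraph R φ)) where
  open ProofStructure R
  open Incidence R
  open Restriction R
  open Composition R
  open Sequents R
  open Erasure R
  open Partial R ok

  switched-≟ : ∀ φ → DecidableEquality (Graph.Node (switchingGraph R φ))
  switched-≟ φ = Sum.≡-dec _≟_ fresh-≟
    where
    fresh-≟ : DecidableEquality (∃[ n ] label n ≡ ⅋)
    fresh-≟ (m , p) (n , q) with m ≟ n
    ... | no m≢n = no (m≢n ∘ cong proj₁)
    ... | yes refl = yes (cong (m ,_) (≡-irrelevant p q))

  switched-cycle : ∀ φ a → Walks.Via (switchingGraph R φ) (_≢ a) (Switched.headᵠ φ a) (inj₁ (tail a)) → ⊥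
  switched-cycle φ a w = no-cycle φ (Walks.cycle (switchingGraph R φ) (switched-≟ φ) a w)

  -- With nothing to avoid, this is merely some good switching, which suffices for every argument
  -- that ends in a cycle.
  module Leftmost = Preference {λ _ → ⊥} (λ _ → no λ ())

  -- Disjoint subsets that are already sequentialized: `class x` is the one that
  -- contains x, and is empty if there is none.
  record State : Set where
    field
      class    : Node → Subset
      coherent : ∀ {x y} → class x ∋ y → class y ≡ class x
      self     : ∀ {x y} → class x ∋ y → class x ∋ x
      seq      : ∀ {x} → class x ∋ x → Seq (class x)
      down     : ∀ a → Erasing R (tail a) → class (tail a) ∋ tail a → class (tail a) ∋ head a

    Done : Node → Set
    Done x = class x ∋ x

    done? : ∀ x → Dec (Done x)
    done? x = class x ∋? x

    done : ∀ {x y} → class x ∋ y → Done y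
    done {x} {y} ∋y = subst (_∋ y) (sym (coherent ∋y)) ∋y

    premise-done : ∀ a → Done (head a) → class (tail a) ≡ class (head a)
    premise-done a d = coherent (upClosed (seq d) a d)

    Ready : Node → Set
    Ready n = (label n ≡ ax ⊎ label n ≡ one)
            ⊎ (Joining (label n) × (∀ a → head a ≡ n → Done (tail a)))
            ⊎ (label n ≡ ⅋ × ∃ λ x → ∀ a → head a ≡ n → Erasing R (tail a) ⊎ class x ∋ tail a)

    ready? : ∀ n → Dec (Ready n)
    ready? n = (ax? ⊎-dec one?)
         ⊎-dec (joining? (label n) ×-dec all? (λ a → (head a ≟ n) →-dec done? (tail a)))
         ⊎-dec (⅋? (label n) ×-dec any? (λ x → all? (λ a →
                  (head a ≟ n) →-dec (erasing? (tail a) ⊎-dec (class x ∋? tail a)))))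
      where
      ax? : Dec (label n ≡ ax)
      ax? with label n
      ... | ax  = yes refl
      ... | cut = no λ ()
      ... | one = no λ ()
      ... | bot = no λ ()
      ... | ⊗   = no λ ()
      ... | ⅋   = no λ ()
      ... | •   = no λ ()
      one? : Dec (label n ≡ one)
      one? with label n
      ... | ax  = no λ ()
      ... | cut = no λ ()
      ... | one = yes refl
      ... | bot = no λ ()
      ... | ⊗   = no λ ()
      ... | ⅋   = no λ ()
      ... | •   = no λ ()

    -- The conditions under which a set may become a class. `Saturated` makes it absorb whole
    -- classes, hence stay disjoint from the others. `Settled` maintains `down`: an erasing node
    -- enters a class only with the node below it, so erasing nodes above an undone ⅋ are not yet
    -- taken by another class.
    Saturated Settled : Subset → Set
    Saturated T = ∀ {x y} → T ∋ x → class x ∋ y → T ∋ y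
    Settled T = ∀ a → Erasing R (tail a) → T ∋ tail a → T ∋ head a

    settled-class : ∀ {x} → Settled (class x)
    settled-class a e ∋t = subst (_∋ head a) (coherent ∋t) (down a e (done ∋t))

  initial : State
  initial = record
    { class = λ _ _ → false ; coherent = λ () ; self = λ () ; seq = λ () ; down = λ _ _ () }

  module Update (st : State) {T : Subset} (sT : Seq T) (sat : State.Saturated st T) (settled : State.Settled st T) where
    open State st

    class′ : Node → Subset
    class′ x = if T x then T else class x

    class-in : ∀ {x} → T ∋ x → class′ x ≡ T
    class-in eq rewrite eq = refl

    class-out : ∀ {x} → ¬ T ∋ x → class′ x ≡ class x
    class-out {x} ∌x with T x
    ... | true  = contradiction refl ∌x
    ... | false = refl

    -- If y were in T, then x, which shares the class of y, would be in T by saturation.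
    apart : ∀ {x y} → ¬ T ∋ x → class x ∋ y → ¬ T ∋ y
    apart {x} {y} ∌x ∋y ∋y′ = ∌x (sat ∋y′ (subst (_∋ x) (sym (coherent ∋y)) (self ∋y)))

    coherent′ : ∀ {x y} → class′ x ∋ y → class′ y ≡ class′ x
    coherent′ {x} {y} ∋y with T ∋? x
    ... | yes ∋x = trans (class-in (subst (_∋ y) (class-in ∋x) ∋y)) (sym (class-in ∋x))
    ... | no ∌x = trans (class-out (apart ∌x ∋y′)) (trans (coherent ∋y′) (sym (class-out ∌x)))
      where ∋y′ = subst (_∋ y) (class-out ∌x) ∋y

    self′ : ∀ {x y} → class′ x ∋ y → class′ x ∋ x
    self′ {x} {y} ∋y with T ∋? x
    ... | yes ∋x = subst (_∋ x) (sym (class-in ∋x)) ∋x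
    ... | no ∌x = subst (_∋ x) (sym (class-out ∌x)) (self (subst (_∋ y) (class-out ∌x) ∋y))

    seq′ : ∀ {x} → class′ x ∋ x → Seq (class′ x)
    seq′ {x} d with T ∋? x
    ... | yes ∋x = subst Seq (sym (class-in ∋x)) sT
    ... | no ∌x = subst Seq (sym (class-out ∌x)) (seq (subst (_∋ x) (class-out ∌x) d))

    down′ : ∀ a → Erasing R (tail a) → class′ (tail a) ∋ tail a → class′ (tail a) ∋ head a
    down′ a e d with T ∋? tail a
    ... | yes ∋t = subst (_∋ head a) (sym (class-in ∋t)) (settled a e ∋t)
    ... | no ∌t = subst (_∋ head a) (sym (class-out ∌t)) (down a e (subst (_∋ tail a) (class-out ∌t) d))

    updated : State
    updated = record { class = class′ ; coherent = coherent′ ; self = self′ ; seq = seq′ ; down = down′ }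

    done-in : ∀ {x} → T ∋ x → State.Done updated x
    done-in {x} ∋x = subst (_∋ x) (sym (class-in ∋x)) ∋x

    done-mono : ∀ {x} → Done x → State.Done updated x
    done-mono {x} d with T ∋? x
    ... | yes ∋x = done-in ∋x
    ... | no ∌x = subst (_∋ x) (sym (class-out ∌x)) d

  module _ (st : State) where
    open State st

    record Sequent (n : Node) : Set where
      field
        set       : Subset
        isSeq     : Seq set
        contains  : set ∋ n
        saturated : Saturated set
        settled   : Settled set

    module Process {n} (core : Core n) (¬done : ¬ Done n) where

      fresh : ∀ {x} → ¬ class x ∋ n
      fresh = ¬done ∘ done

      process-leaf : label n ≡ ax ⊎ label n ≡ one → Sequent n
      process-leaf lab = record
        { set = single n
        ; isSeq = leaf n lab (∋-single n) single-∋
        ; contains = ∋-single n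
        ; saturated = λ ∋x ∋y → contradiction (self (subst (λ z → class z ∋ _) (single-∋ ∋x) ∋y)) ¬done
        ; settled = λ a e ∋t → contradiction (subst (Erasing R) (single-∋ ∋t) e) (proj₁ core)
        }

      process-join : Joining (label n) → (∀ a → head a ≡ n → Done (tail a)) → Sequent n
      process-join j prem with p , q , hp , hq , p≢q ← joining-premises j = record
        { set = S₁ ∪ S₂ ∪ single n
        ; isSeq = join n p q S₁ S₂ (joining-label j) hp hq p≢q (prem p hp) (prem q hq) disjoint
                    (seq (prem p hp)) (seq (prem q hq)) A
        ; contains = Adds.added A
        ; saturated = saturated
        ; settled = settled
        }
        where
        S₁ S₂ : Subset
        S₁ = class (tail p)
        S₂ = class (tail q)
        A : Adds (S₁ ∪ S₂) n (S₁ ∪ S₂ ∪ single n)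
        A = adds (either′ fresh fresh ∘ ∨-split {S₁ n})
        sub₁ : S₁ ⊆ (S₁ ∪ S₂ ∪ single n)
        sub₁ = Adds.mono A ∘ ∨-left
        sub₂ : S₂ ⊆ (S₁ ∪ S₂ ∪ single n)
        sub₂ {x} = Adds.mono A ∘ ∨-right {S₁ x}
        cases : ∀ {x} → S₁ ∪ S₂ ∪ single n ∋ x → (S₁ ∋ x ⊎ S₂ ∋ x) ⊎ x ≡ n
        cases {x} ∋x = either′ (inj₁ ∘ ∨-split {S₁ x}) inj₂ (Adds.only A ∋x)
        premise-live : ∀ {a} → head a ≡ n → Live (tail a)
        premise-live refl = joining-premise-live j

        φ : Switching R
        φ = Leftmost.switching
        open Walks (switchingGraph R φ)
        open Switched φ
        headᵠ-n : ∀ {a} → head a ≡ n → headᵠ a ≡ inj₁ n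
        headᵠ-n refl = headᵠ-plain (joining≢⅋ j)

        -- From n go up along q, then inside the class to the tail of p. The arcs used inside have
        -- their heads in the class, which does not contain n, so none of them is p, and p closes a
        -- cycle.
        same-class : ¬ S₁ ∋ tail q
        same-class ∋q = switched-cycle φ p
          (subst (λ z → Via (_≢ p) z (inj₁ (tail p))) (sym (headᵠ-n hp))
            (back q (headᵠ-n hq) (p≢q ∘ sym)
              (weaken (λ (_ , ∋h) eq → fresh (subst (S₁ ∋_) (trans (cong head eq) hp) ∋h))
                (inside-connected φ Leftmost.good (seq (prem p hp)) ∋q (prem p hp) (premise-live hq) (premise-live hp)))))

        disjoint : ∀ x → S₁ ∋ x → ¬ S₂ ∋ x
        disjoint x ∋₁ ∋₂ = same-class (subst (_∋ tail q) (trans (sym (coherent ∋₂)) (coherent ∋₁)) (prem q hq))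

        saturated : Saturated (S₁ ∪ S₂ ∪ single n)
        saturated ∋x ∋y with cases ∋x
        ... | inj₁ (inj₁ ∋₁) = sub₁ (subst (_∋ _) (coherent ∋₁) ∋y)
        ... | inj₁ (inj₂ ∋₂) = sub₂ (subst (_∋ _) (coherent ∋₂) ∋y)
        ... | inj₂ refl = contradiction (self ∋y) ¬done

        settled : Settled (S₁ ∪ S₂ ∪ single n)
        settled a e ∋t with cases ∋t
        ... | inj₁ (inj₁ ∋₁) = sub₁ (settled-class a e ∋₁)
        ... | inj₁ (inj₂ ∋₂) = sub₂ (settled-class a e ∋₂)
        ... | inj₂ refl = contradiction e (proj₁ core)

      -- By `down`, a done node on the lead would make the next one done, and so on to n, which is
      -- undone.
      lead-undone : ∀ {T x} → Lead T n x → ¬ Done x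
      lead-undone (last a refl e refl) d = fresh (down a e d)
      lead-undone (more a refl e _ l) d = lead-undone l (done (down a e d))

      -- An erasing node that is the tail of an arc is a ⊥ or a ⅋ and has one conclusion, so `a` is
      -- the first arc of the lead.
      settled-lead : ∀ {T x} → T ∋ n → Lead T n x → ∀ a → tail a ≡ x → T ∋ head a
      settled-lead {T} ∋n l a refl = go l (weak-single (lead-erasing l))
        where
        weak-single : Erasing R (tail a) → ∃ λ k → label (tail a) ≡ k × Single k
        weak-single (erasing (inj₁ eq) _) = _ , eq , bot-single
        weak-single (erasing (inj₂ (inj₁ eq)) _) = _ , eq , ⅋-single
        weak-single (erasing (inj₂ (inj₂ eq)) _) = contradiction eq (tail≢• a)
        go : Lead T n (tail a) → (∃ λ k → label (tail a) ≡ k × Single k) → T ∋ head a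
        go (last b t _ refl) (_ , eq , s) with refl ← conclusion-unique eq s t refl = ∋n
        go (more b t _ ∋h _) (_ , eq , s) with refl ← conclusion-unique eq s t refl = ∋h

      enlarge : ∀ {S} a → head a ≡ n → Erasing R (tail a) ⊎ S ∋ tail a → Seq S →
                Σ[ E ∈ Enlargement S n ] Enlargement.set E ∋ tail a
      enlarge a h (inj₁ e) s = enlarge-arc a h e s
      enlarge a h (inj₂ ∋t) s = unchanged s , ∋t

      process-⅋ : label n ≡ ⅋ → ∀ x → (∀ a → head a ≡ n → Erasing R (tail a) ⊎ class x ∋ tail a) → Sequent n
      process-⅋ is⅋ x prem = record
        { set = S ∪ single n
        ; isSeq = step n S (inj₂ is⅋) premises∈ (Enlargement.seq E) A
        ; contains = Adds.added A
        ; saturated = saturated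
        ; settled = settled
        }
        where
        o : Ordered (label n)
        o = ⅋-ordered-at is⅋
        l r : Arc
        l = left n o
        r = right n o
        -- `Ready` allows an empty class, but n is not erasing, so at least one of its premises
        -- comes from the class of x.
        occupied : class x ∋ x
        occupied with prem l (head-left n o) | prem r (head-right n o)
        ... | inj₂ ∋t | _ = self ∋t
        ... | inj₁ _ | inj₂ ∋t = self ∋t
        ... | inj₁ e | inj₁ e′ = contradiction (erasing (inj₂ (inj₁ is⅋)) both) (proj₁ core)
          where
          both : ∀ a → head a ≡ n → Erasing R (tail a)
          both a h with ordered-premise o a h
          ... | inj₁ refl = e
          ... | inj₂ refl = e′
        E₁ : Σ[ E ∈ Enlargement (class x) n ] Enlargement.set E ∋ tail l
        E₁ = enlarge l (head-left n o) (prem l (head-left n o)) (seq occupied)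
        E₂ : Σ[ E ∈ Enlargement (Enlargement.set (proj₁ E₁)) n ] Enlargement.set E ∋ tail r
        E₂ = enlarge r (head-right n o)
          (either′ inj₁ (inj₂ ∘ Enlargement.mono (proj₁ E₁)) (prem r (head-right n o))) (Enlargement.seq (proj₁ E₁))
        E : Enlargement (class x) n
        E = enlarge-trans (proj₁ E₁) (proj₁ E₂)
        S : Subset
        S = Enlargement.set E
        premises∈ : ∀ a → head a ≡ n → S ∋ tail a
        premises∈ a h with ordered-premise o a h
        ... | inj₁ refl = Enlargement.mono (proj₁ E₂) (proj₂ E₁)
        ... | inj₂ refl = proj₂ E₂
        A : Adds S n (S ∪ single n)
        -- The enlargement cannot have added n already: a lead starts at an erasing node, and n is
        -- live.
        A = adds λ ∋n → either′ fresh (proj₁ core ∘ lead-erasing) (Enlargement.only E ∋n)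
        sub : class x ⊆ (S ∪ single n)
        sub = Adds.mono A ∘ Enlargement.mono E
        cases : ∀ {y} → S ∪ single n ∋ y → class x ∋ y ⊎ Lead (S ∪ single n) n y ⊎ y ≡ n
        cases ∋y = either′ (λ ∋y′ → either′ inj₁ (inj₂ ∘ inj₁ ∘ lead-mono (Adds.mono A)) (Enlargement.only E ∋y′))
                           (inj₂ ∘ inj₂) (Adds.only A ∋y)
        saturated : Saturated (S ∪ single n)
        saturated ∋y ∋z with cases ∋y
        ... | inj₁ ∋y′ = sub (subst (_∋ _) (coherent ∋y′) ∋z)
        ... | inj₂ (inj₁ lead) = contradiction (self ∋z) (lead-undone lead)
        ... | inj₂ (inj₂ refl) = contradiction (self ∋z) ¬done
        settled : Settled (S ∪ single n)
        settled a e ∋t with cases ∋t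
        ... | inj₁ ∋t′ = sub (settled-class a e ∋t′)
        ... | inj₂ (inj₁ lead) = settled-lead (Adds.added A) lead a refl
        ... | inj₂ (inj₂ refl) = contradiction e (proj₁ core)

      process : Ready n → Sequent n
      process (inj₁ lab) = process-leaf lab
      process (inj₂ (inj₁ (j , prem))) = process-join j prem
      process (inj₂ (inj₂ (is⅋ , x , prem))) = process-⅋ is⅋ x prem

    Stuck : Set
    Stuck = ∀ n → Core n → ¬ Done n → ¬ Ready n

    advance : Stuck ⊎ (Σ[ st′ ∈ State ] (∀ {x} → Done x → State.Done st′ x) × ∃ λ n → ¬ Done n × State.Done st′ n)
    advance with any? (λ n → core? n ×-dec ¬? (done? n) ×-dec ready? n)
    ... | no none = inj₁ λ n c ¬d r → none (n , c , ¬d , r)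
    ... | yes (n , c , ¬d , r) = inj₂ (U.updated , U.done-mono , n , ¬d , U.done-in contains)
      where
      open Sequent (Process.process c ¬d r)
      module U = Update st isSeq saturated settled

  #undone : State → ℕ
  #undone st = length (filter (λ x → ¬? (State.done? st x)) (allFin #nodes))

  undone-decreases : ∀ st st′ → (∀ {x} → State.Done st x → State.Done st′ x) →
                     ∀ {n} → ¬ State.Done st n → State.Done st′ n → #undone st′ < #undone st
  undone-decreases st st′ mono {n} ¬d d =
    filter-strict (λ x → ¬? (State.done? st′ x)) (λ x → ¬? (State.done? st x)) (_∘ mono) (∈-allFin n) (λ ¬d′ → ¬d′ d) ¬d

  -- `k` bounds the number of undone nodes, which every step lowers.
  run : ∀ k (st : State) → #undone st ≤ k → Σ[ st′ ∈ State ] Stuck st′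
  run k st bound with advance st
  ... | inj₁ stuck = st , stuck
  run zero st bound | inj₂ (st′ , mono , n , ¬d , d) =
    contradiction (≤-trans (undone-decreases st st′ mono ¬d d) bound) λ ()
  run (suc k) st bound | inj₂ (st′ , mono , n , ¬d , d) =
    run k st′ (s≤s⁻¹ (≤-trans (undone-decreases st st′ mono ¬d d) bound))

  stuck-state : Σ[ st ∈ State ] Stuck st
  stuck-state = run _ initial ≤-refl

-- Counting the components of a switching graph.

module Counting (R : ProofStructure) (ok : [¬w⊗] R) (acc♯w : ACC♯w R) where
  open ProofStructure R
  open Incidence R
  open Restriction R
  open Erasure R
  open Partial R ok

  bots : List Node
  bots = filter (λ n → bot? (label n)) (allFin #nodes)

  bots-unique : Unique bots
  bots-unique = Unique.filter⁺ (λ n → bot? (label n)) (Unique.allFin⁺ #nodes)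

  bots-bot : ∀ i → label (lookup bots i) ≡ bot
  bots-bot i = proj₂ (∈-filter⁻ (λ n → bot? (label n)) {xs = allFin #nodes} (∈-lookup {xs = bots} i))

  ∈-bots : ∀ {b} → label b ≡ bot → b ∈ bots
  ∈-bots {b} = ∈-filter⁺ (λ n → bot? (label n)) (∈-allFin b)

  bot≢• : ∀ {v} → label v ≡ bot → label v ≢ •
  bot≢• e e′ = contradiction (trans (sym e) e′) λ ()

  head-kind : ∀ a → label (head a) ≡ ⅋ ⊎ label (head a) ≡ • ⊎ Joining (label (head a))
  head-kind a with label (head a) in eq
  ... | ax  = contradiction refl (premiseless eq ax-premiseless a)
  ... | cut = inj₂ (inj₂ cut-joining)
  ... | one = contradiction refl (premiseless eq one-premiseless a)
  ... | bot = contradiction refl (premiseless eq bot-premiseless a)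
  ... | ⊗   = inj₂ (inj₂ ⊗-joining)
  ... | ⅋   = inj₁ refl
  ... | •   = inj₂ (inj₁ refl)

  -- In a switching graph a component of erasing nodes contains one ⊥, reached
  -- by climbing along the chosen premises.
  module _ (φ : Switching R) where
    open Switching φ
    open Switched φ
    open Graph.NumberOfComponents (proj₂ (acc♯w φ))
    open Walks (switchingGraph R φ)

    data Root : Node → Node → Set where
      found : ∀ {b} → label b ≡ bot → Root b b
      climb : ∀ {n b} p → Root (tail (choice n p)) b → Root n b

    root-bot : ∀ {n b} → Root n b → label b ≡ bot
    root-bot (found e) = e
    root-bot (climb _ r) = root-bot r

    root-unique : ∀ {n b c} → Root n b → Root n c → b ≡ c
    root-unique (found _) (found _) = refl
    root-unique (found e) (climb p _) = contradiction (trans (sym e) p) λ ()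
    root-unique (climb p _) (found e) = contradiction (trans (sym e) p) λ ()
    root-unique (climb p r) (climb p′ r′) with refl ← ≡-irrelevant p p′ = root-unique r r′

    root : ∀ {n} → Erasing R n → label n ≢ • → ∃ λ b → Root n b
    root (erasing (inj₁ e) _) _ = _ , found e
    root (erasing (inj₂ (inj₁ p)) ps) _
      with b , r ← root (ps (choice _ p) (choice-premise _ p)) (tail≢• _) = b , climb p r
    root (erasing (inj₂ (inj₂ e)) _) ≢• = contradiction e ≢•

    root-connected : ∀ {n b} → Root n b → Via (λ _ → ⊤) (inj₁ n) (inj₁ b)
    root-connected (found _) = stop
    root-connected (climb p r) = back (choice _ p) (headᵠ-chosen _ p) tt (root-connected r)

    -- Every node would be connected to some ⊥: an erasing node to its root, a • node, old or fresh,
    -- through its only arc. Choosing a ⊥ in each of the `suc #bot` components would then inject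
    -- them into the `#bot` many ⊥ nodes.
    no-core-absurd : ¬ (∀ n → ¬ Core n)
    no-core-absurd none = 1+n≰n (injective⇒≤ {f = bot-index} bot-index-inj)
      where
      node-to-bot : ∀ v → label v ≢ • → ∃ λ b → label b ≡ bot × Via (λ _ → ⊤) (inj₁ v) (inj₁ b)
      node-to-bot v ≢• with erasing? v
      ... | no live = contradiction (live , ≢•) (none v)
      ... | yes e with b , r ← root e ≢• = b , root-bot r , root-connected r

      arc-to-bot : ∀ a → ∃ λ b → label b ≡ bot × Via (λ _ → ⊤) (headᵠ a) (inj₁ b)
      arc-to-bot a with b , e , w ← node-to-bot (tail a) (tail≢• a) = b , e , back a refl tt w

      unchosen : ∀ n p → ∃ λ a → headᵠ a ≡ inj₂ (n , p)
      unchosen n p with left n o ≟ choice n p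
        where o = ⅋-ordered-at p
      ... | no ≢c = left n o , headᵠ-unchosen n p (head-left n o) ≢c
        where o = ⅋-ordered-at p
      ... | yes ≡c = right n o , headᵠ-unchosen n p (head-right n o) (λ eq → left≢right n o (trans ≡c (sym eq)))
        where o = ⅋-ordered-at p

      to-bot : ∀ s → ∃ λ b → label b ≡ bot × Via (λ _ → ⊤) s (inj₁ b)
      to-bot (inj₂ (n , p)) with a , eq ← unchosen n p =
        subst (λ s → ∃ λ b → label b ≡ bot × Via (λ _ → ⊤) s (inj₁ b)) eq (arc-to-bot a)
      to-bot (inj₁ v) with •? (label v)
      ... | no ≢• = node-to-bot v ≢•
      ... | yes e with a , refl ← •-premise e =
        subst (λ s → ∃ λ b → label b ≡ bot × Via (λ _ → ⊤) s (inj₁ b))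
          (headᵠ-plain (λ e′ → contradiction (trans (sym e) e′) λ ())) (arc-to-bot a)

      representative : ∀ i → ∃ λ b → label b ≡ bot × component (inj₁ b) ≡ i
      representative i with s , eq ← surjective i with b , e , w ← to-bot s =
        b , e , trans (sym (Equivalence.from (correct s (inj₁ b)) (connected w))) (eq refl)

      bot-index : Fin (suc #bot) → Fin #bot
      bot-index i = index (∈-bots (proj₁ (proj₂ (representative i))))

      bot-at : ∀ i → proj₁ (representative i) ≡ lookup bots (bot-index i)
      bot-at i = lookup-index (∈-bots (proj₁ (proj₂ (representative i))))

      bot-index-inj : Injective _≡_ _≡_ bot-index
      bot-index-inj {i} {j} eq = trans (sym (proj₂ (proj₂ (representative i))))
        (trans (cong (component ∘ inj₁) (trans (bot-at i) (trans (cong (lookup bots) eq) (sym (bot-at j)))))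
               (proj₂ (proj₂ (representative j))))

    -- An invariant of components: an erasing node is coloured by its root ⊥, a live node by whether
    -- it lies in C. The hypothesis `closed` makes the second kind of colour constant along kept
    -- arcs between live nodes.
    module Isolation (good : Good φ) (C : Subset)
      (closed : ∀ a → headᵠ a ≡ inj₁ (head a) → Core (head a) → Live (tail a) →
                (C ∋ tail a → C ∋ head a) × (C ∋ head a → C ∋ tail a)) where

      data Colour : Node → Node ⊎ Bool → Set where
        erased  : ∀ {v b} → Erasing R v → Root v b → Colour v (inj₁ b)
        inside  : ∀ {v} → Live v → C ∋ v → Colour v (inj₂ true)
        outside : ∀ {v} → Live v → ¬ C ∋ v → Colour v (inj₂ false)

      -- A • node, old or fresh, has a single arc and takes the colour of its tail. Old ones get no
      -- colour of their own, so that colours stay constant along the arcs into them.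
      Colourᵠ : Node ⊎ (∃[ n ] label n ≡ ⅋) → Node ⊎ Bool → Set
      Colourᵠ (inj₁ v) k = (label v ≢ • × Colour v k) ⊎ (label v ≡ • × ∃ λ a → head a ≡ v × Colour (tail a) k)
      Colourᵠ (inj₂ (n , p)) k = ∃ λ a → head a ≡ n × a ≢ choice n p × Colour (tail a) k

      colour-unique : ∀ {v k l} → Colour v k → Colour v l → k ≡ l
      colour-unique (erased _ r) (erased _ r′) = cong inj₁ (root-unique r r′)
      colour-unique (erased e _) (inside ¬e _) = contradiction e ¬e
      colour-unique (erased e _) (outside ¬e _) = contradiction e ¬e
      colour-unique (inside ¬e _) (erased e _) = contradiction e ¬e
      colour-unique (inside _ _) (inside _ _) = refl
      colour-unique (inside _ ∋v) (outside _ ∌v) = contradiction ∋v ∌v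
      colour-unique (outside ¬e _) (erased e _) = contradiction e ¬e
      colour-unique (outside _ ∌v) (inside _ ∋v) = contradiction ∋v ∌v
      colour-unique (outside _ _) (outside _ _) = refl

      unchosen-unique : ∀ {n a b} p → head a ≡ n → head b ≡ n → a ≢ choice n p → b ≢ choice n p → a ≡ b
      unchosen-unique {n} {a} {b} p ha hb a≢ b≢
        with is a ha | is b hb | is (choice n p) (choice-premise n p)
        where
        is : ∀ c → head c ≡ n → c ≡ left n (⅋-ordered-at p) ⊎ c ≡ right n (⅋-ordered-at p)
        is = ordered-premise (⅋-ordered-at p)
      ... | inj₁ x | inj₁ y | _ = trans x (sym y)
      ... | inj₂ x | inj₂ y | _ = trans x (sym y)
      ... | inj₁ x | inj₂ y | inj₁ z = contradiction (trans x (sym z)) a≢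
      ... | inj₁ x | inj₂ y | inj₂ z = contradiction (trans y (sym z)) b≢
      ... | inj₂ x | inj₁ y | inj₁ z = contradiction (trans y (sym z)) b≢
      ... | inj₂ x | inj₁ y | inj₂ z = contradiction (trans x (sym z)) a≢

      colourᵠ-unique : ∀ s {k l} → Colourᵠ s k → Colourᵠ s l → k ≡ l
      colourᵠ-unique (inj₁ v) (inj₁ (_ , c)) (inj₁ (_ , c′)) = colour-unique c c′
      colourᵠ-unique (inj₁ v) (inj₁ (≢• , _)) (inj₂ (e , _)) = contradiction e ≢•
      colourᵠ-unique (inj₁ v) (inj₂ (e , _)) (inj₁ (≢• , _)) = contradiction e ≢•
      colourᵠ-unique (inj₁ v) (inj₂ (e , a , ha , c)) (inj₂ (_ , b , hb , c′))
        with refl ← •-premise-unique e ha hb = colour-unique c c′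
      colourᵠ-unique (inj₂ (n , p)) (a , ha , a≢ , c) (b , hb , b≢ , c′)
        with refl ← unchosen-unique p ha hb a≢ b≢ = colour-unique c c′

      colour : ∀ v → label v ≢ • → ∃ λ k → Colour v k
      colour v ≢• with erasing? v | C ∋? v
      ... | yes e | _ = inj₁ _ , erased e (proj₂ (root e ≢•))
      ... | no ¬e | yes ∋v = inj₂ true , inside ¬e ∋v
      ... | no ¬e | no ∌v = inj₂ false , outside ¬e ∌v

      colour-live : ∀ {a k} → headᵠ a ≡ inj₁ (head a) → Core (head a) → Live (tail a) →
                    Colour (tail a) k → Colour (head a) k
      colour-live kept core live (erased e _) = contradiction e live
      colour-live kept core live (inside _ ∋t) = inside (proj₁ core) (proj₁ (closed _ kept core live) ∋t)
      colour-live kept core live (outside _ ∌t) = outside (proj₁ core) (∌t ∘ proj₂ (closed _ kept core live))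

      ⅋≢• : ∀ {v} → label v ≡ ⅋ → label v ≢ •
      ⅋≢• e e′ = contradiction (trans (sym e) e′) λ ()

      -- Goodness enters here: an erasing chosen premise forces the ⅋ to be erasing, and climbing
      -- along that premise gives it the same root.
      colour-chosen : ∀ n p {k} → Colour (tail (choice n p)) k → Colour n k
      colour-chosen n p c with erasing? (tail (choice n p))
      colour-chosen n p (erased _ r) | yes e = erased (good n p e) (climb p r)
      colour-chosen n p (inside ¬e _) | yes e = contradiction e ¬e
      colour-chosen n p (outside ¬e _) | yes e = contradiction e ¬e
      colour-chosen n p {k} c | no live = subst (λ m → Colour m k) h≡n
        (colour-live (trans (headᵠ-chosen n p) (cong inj₁ (sym h≡n)))
          ((λ e → live (erasing-premise e refl)) , λ e → ⅋≢• p (trans (cong label (sym h≡n)) e)) live c)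
        where
        h≡n : head (choice n p) ≡ n
        h≡n = choice-premise n p

      colour-arc : ∀ a {k} → Colour (tail a) k → Colourᵠ (headᵠ a) k
      colour-arc a {k} c with head-kind a
      ... | inj₂ (inj₁ e) =
        subst (λ s → Colourᵠ s k) (sym (headᵠ-plain (λ e′ → ⅋≢• e′ e))) (inj₂ (e , a , refl , c))
      ... | inj₂ (inj₂ j) = subst (λ s → Colourᵠ s k) (sym plain)
        (inj₁ (joining≢• j , colour-live plain (joining-live j , joining≢• j) (joining-premise-live j) c))
        where
        plain : headᵠ a ≡ inj₁ (head a)
        plain = headᵠ-plain (joining≢⅋ j)
      ... | inj₁ p with a ≟ choice (head a) p
      ...   | no a≢ = subst (λ s → Colourᵠ s k) (sym (headᵠ-unchosen (head a) p refl a≢)) (a , refl , a≢ , c)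
      ...   | yes a≡ = subst (λ s → Colourᵠ s k) (sym (trans (cong headᵠ a≡) (headᵠ-chosen (head a) p)))
        (inj₁ (⅋≢• p , colour-chosen (head a) p (subst (λ b → Colour (tail b) k) a≡ c)))

      colour-connected : ∀ {s t k} → Graph.Connected (switchingGraph R φ) s t → Colourᵠ s k → Colourᵠ t k
      colour-connected ε c = c
      colour-connected (fwd (a , refl , refl) ◅ w) (inj₁ (_ , c)) = colour-connected w (colour-arc a c)
      colour-connected (fwd (a , refl , refl) ◅ w) (inj₂ (e , _)) = contradiction e (tail≢• a)
      -- Backwards, the tail has some colour, which the arc carries to its head; uniqueness at the
      -- head identifies it with `k`.
      colour-connected {k = k} (bwd (a , refl , refl) ◅ w) c
        with l , c′ ← colour (tail a) (tail≢• a)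
        with refl ← colourᵠ-unique (headᵠ a) c (colour-arc a c′) = colour-connected w (inj₁ (tail≢• a , c′))

      -- Together with all ⊥ nodes, x and y carry `#bot` + 2 different colours, hence lie in
      -- different components, one more than there are.
      isolated : ∀ {x y} → Core x → C ∋ x → Core y → ¬ C ∋ y → ⊥
      isolated {x} {y} (lx , x≢•) ∋x (ly , y≢•) ∌y = 1+n≰n (injective⇒≤ {f = component ∘ inj₁ ∘ node} node-inj)
        where
        node : Fin (suc (suc #bot)) → Node
        node zero = x
        node (suc zero) = y
        node (suc (suc i)) = lookup bots i
        hue : Fin (suc (suc #bot)) → Node ⊎ Bool
        hue zero = inj₂ true
        hue (suc zero) = inj₂ false
        hue (suc (suc i)) = inj₁ (lookup bots i)
        node-hue : ∀ i → Colourᵠ (inj₁ (node i)) (hue i)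
        node-hue zero = inj₁ (x≢• , inside lx ∋x)
        node-hue (suc zero) = inj₁ (y≢• , outside ly ∌y)
        node-hue (suc (suc i)) = inj₁ (bot≢• (bots-bot i) , erased (bot-erasing (bots-bot i)) (found (bots-bot i)))
        hue-inj : ∀ i j → hue i ≡ hue j → i ≡ j
        hue-inj zero zero _ = refl
        hue-inj zero (suc zero) ()
        hue-inj zero (suc (suc _)) ()
        hue-inj (suc zero) (suc zero) _ = refl
        hue-inj (suc (suc i)) (suc (suc j)) eq =
          cong (λ k → suc (suc k)) (lookup-injective bots-unique (inj₁-injective eq))
        node-inj : Injective _≡_ _≡_ (component ∘ inj₁ ∘ node)
        node-inj {i} {j} eq = hue-inj i j (colourᵠ-unique (inj₁ (node j))
          (colour-connected (Equivalence.to (correct (inj₁ (node i)) (inj₁ (node j))) eq) (node-hue i)) (node-hue j))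

-- From a stuck state to a derivation of all nodes.

module Sequentialization (R : ProofStructure) (ok : [¬w⊗] R) (acc♯w : ACC♯w R) where
  open ProofStructure R
  open Incidence R
  open Restriction R
  open Sequents R
  open Erasure R
  open Partial R ok
  open Contraction R ok (λ φ → proj₁ (acc♯w φ))
  open Counting R ok acc♯w

  module _ (st : State) (stuck : Stuck st) where
    open State st

    Exit : Node → Arc → Set
    Exit x e = class x ∋ tail e × Joining (label (head e)) × ¬ class x ∋ head e

    -- A done node shares the class of its premises by upward closure, so an arc that leaves a class
    -- cannot end at one.
    exit-undone : ∀ {x e} → Exit x e → ¬ Done (head e)
    exit-undone {x} {e} (∋t , _ , ∌h) d =
      ∌h (subst (_∋ head e) (trans (sym (premise-done e d)) (coherent ∋t)) d)

    exit : ∀ {x y} → Done x → Live x → Core y → ¬ class x ∋ y → ∃ (Exit x)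
    exit {x} {y} d live core ∌y
      with any? (λ e → (class x ∋? tail e) ×-dec joining? (label (head e)) ×-dec ¬? (class x ∋? head e))
    ... | yes witness = witness
    ... | no none = ⊥-elim (I.isolated (live , noBullet (seq d) x d) d core ∌y)
      where
      module Avoiding = Preference {λ a → class x ∋ tail a} (λ a → class x ∋? tail a)
      φ : Switching R
      φ = Avoiding.switching
      open Switching φ using (choice)
      open Switched φ

      entered : ∀ a → headᵠ a ≡ inj₁ (head a) → Core (head a) → class x ∋ tail a → class x ∋ head a
      entered a kept c ∋t with head-kind a
      ... | inj₂ (inj₁ e) = contradiction e (proj₂ c)
      ... | inj₂ (inj₂ j) with class x ∋? head a
      ...   | yes ∋h = ∋h
      ...   | no ∌h = contradiction (a , ∋t , j , ∌h) none
      entered a kept c ∋t | inj₁ p with a ≟ choice (head a) p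
      ... | no a≢ = contradiction (trans (sym kept) (headᵠ-unchosen (head a) p refl a≢)) λ ()
      ... | yes a≡ with done? (head a)
      ...   | yes dh = subst (_∋ head a) (trans (sym (premise-done a dh)) (coherent ∋t)) dh
      -- The switching takes a premise from the class at this live ⅋ only when each premise is
      -- erasing or comes from the class as well. The ⅋ would then be ready.
      ...   | no ¬dh = contradiction (inj₂ (inj₂ (p , x , Avoiding.avoided (head a) p chosen))) (stuck (head a) c ¬dh)
        where
        chosen : class x ∋ tail (choice (head a) p)
        chosen = subst (λ b → class x ∋ tail b) a≡ ∋t

      -- By upward closure no arc enters the class from outside; only the arcs leaving it depend on
      -- the switching and on the lack of exits.
      module I = Isolation φ Avoiding.good (class x) (λ a kept c _ → entered a kept c , upClosed (seq d) a)

    -- If every class of live nodes has an exit, one can walk forever in a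
    -- switching graph without turning back: from an undone node up to a premise,
    -- then, if that premise is done, through its class to the exit and down.
    module Walking (exits : ∀ {x} → Done x → Live x → ∃ (Exit x)) where

      φ : Switching R
      φ = Leftmost.switching
      open Switching φ
      open Switched φ
      open Walks (switchingGraph R φ)

      Pending : Node → Set
      Pending u = Core u × ¬ Done u

      -- The field `undone` prevents turning back: an exit reaches a ⊗ or cut along an arc with a
      -- done tail, hence not along the `arc` selected there.
      record Premise (u : Node) : Set where
        field
          arc      : Arc
          head-arc : head arc ≡ u
          kept     : headᵠ arc ≡ inj₁ u
          live     : Live (tail arc)
          undone   : Joining (label u) → ¬ Done (tail arc)

      open Premise

      joining-premise : ∀ {u} → Pending u → Joining (label u) → Premise u
      joining-premise {u} (core , ¬d) j with any? (λ a → (head a ≟ u) ×-dec ¬? (done? (tail a)))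
      ... | yes (a , refl , ¬dt) = record
        { arc = a ; head-arc = refl ; kept = headᵠ-plain (joining≢⅋ j)
        ; live = joining-premise-live j ; undone = λ _ → ¬dt }
      ... | no none = contradiction (inj₂ (inj₁ (j , all-done))) (stuck u core ¬d)
        where
        all-done : ∀ a → head a ≡ u → Done (tail a)
        all-done a h with done? (tail a)
        ... | yes dt = dt
        ... | no ¬dt = contradiction (a , h , ¬dt) none

      premise : ∀ {u} → Pending u → Premise u
      premise {u} pending@((live , ≢•) , ¬d) = by-label _ refl
        where
        by-label : ∀ l → label u ≡ l → Premise u
        by-label ax  eq = contradiction (inj₁ (inj₁ eq)) (stuck u (live , ≢•) ¬d)
        by-label one eq = contradiction (inj₁ (inj₂ eq)) (stuck u (live , ≢•) ¬d)
        by-label bot eq = contradiction (bot-erasing eq) live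
        by-label •   eq = contradiction eq ≢•
        by-label cut eq = joining-premise pending (subst Joining (sym eq) cut-joining)
        by-label ⊗   eq = joining-premise pending (subst Joining (sym eq) ⊗-joining)
        by-label ⅋   eq = record
          { arc = choice u eq ; head-arc = choice-premise u eq ; kept = headᵠ-chosen u eq
          ; live = live ∘ Leftmost.good u eq
          ; undone = λ j → contradiction eq (joining≢⅋ j) }

      -- The avoided arc belongs to an arbitrary undone node t, which will be the node where the
      -- walk closes. Arcs inside a class have done heads, unlike `arc a`; an exit has a done tail,
      -- whereas `arc a` has an undone one whenever t is a ⊗ or cut.
      onwards : ∀ {u} (b : Premise u) → Σ[ v ∈ ∃ Pending ] (∀ {t} (a : Premise t) → ¬ Done t →
                Via (_≢ arc a) (inj₁ (tail (arc b))) (inj₁ (proj₁ v)))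
      onwards b with done? (tail (arc b))
      ... | no ¬d = (tail (arc b) , (live b , tail≢• (arc b)) , ¬d) , λ _ _ → stop
      ... | yes d with e , ex@(∋t , j , ∌h) ← exits d (live b) =
        (head e , (joining-live j , joining≢• j) , exit-undone {e = e} ex) , λ a ¬dt →
          weaken (λ (_ , ∋h) eq → ¬dt (subst Done (trans (cong head eq) (head-arc a)) (done ∋h)))
            (inside-connected φ Leftmost.good (seq d) d ∋t (live b) (joining-premise-live j))
          ⊙ along e refl (λ eq → undone a (subst (Joining ∘ label) (trans (cong head eq) (head-arc a)) j)
                                   (subst (Done ∘ tail) eq (done ∋t)))
              (subst (λ s → Via (_≢ arc a) s (inj₁ (head e))) (sym (headᵠ-plain (joining≢⅋ j))) stop)

      next : ∃ Pending → ∃ Pending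
      next (u , pending) = proj₁ (onwards (premise pending))

      iterate : ℕ → ∃ Pending → ∃ Pending
      iterate zero s = s
      iterate (suc k) s = iterate k (next s)

      iterate-+ : ∀ m k s → iterate (m + k) s ≡ iterate k (iterate m s)
      iterate-+ zero k s = refl
      iterate-+ (suc m) k s = iterate-+ m k (next s)

      -- The walk is cut at its first visit to t, so each arc climbed before has a head other than t
      -- and differs from `arc a`.
      return : ∀ k s {t} (a : Premise t) → ¬ Done t → proj₁ (iterate k s) ≡ t →
               Via (_≢ arc a) (inj₁ (proj₁ s)) (inj₁ t)
      return k s@(u , pending) {t} a ¬dt eq with u ≟ t
      return k s a ¬dt eq | yes refl = stop
      return zero s a ¬dt eq | no u≢t = contradiction eq u≢t
      return (suc k) s@(u , pending) a ¬dt eq | no u≢t =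
        back (arc b) (kept b) (λ eq′ → u≢t (trans (sym (head-arc b)) (trans (cong head eq′) (head-arc a))))
          (proj₂ (onwards b) a ¬dt ⊙ return k (next s) a ¬dt eq)
        where
        b : Premise u
        b = premise pending

      -- The walk leaves t upwards along `arc a` and comes back to t without that arc, which makes a
      -- cycle.
      no-return : ∀ s k → proj₁ (iterate (suc k) s) ≢ proj₁ s
      no-return (t , pending) k eq = switched-cycle φ (arc a)
        (subst (λ z → Via (_≢ arc a) z (inj₁ (tail (arc a)))) (sym (kept a))
          (reverse (proj₂ (onwards a) a (proj₂ pending) ⊙ return k (next (t , pending)) a (proj₂ pending) eq)))
        where
        a : Premise t
        a = premise pending

      no-pending : ¬ ∃ Pending
      no-pending s with i , j , i<j , eq ← pigeonhole (n<1+n #nodes) (λ i → proj₁ (iterate (toℕ i) s))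
                   -- Since `i<j` unfolds to suc i ≤ j, k is j - i - 1, and the two visits are suc k
                   -- steps apart.
                   with k , i+k≡j ← m≤n⇒∃[o]m+o≡n i<j =
        no-return (iterate (toℕ i) s) k (trans (cong proj₁ later-visit) (sym eq))
        where
        later-visit : iterate (suc k) (iterate (toℕ i) s) ≡ iterate (toℕ j) s
        later-visit = trans (sym (iterate-+ (toℕ i) (suc k) s))
          (cong (λ m → iterate m s) (trans (+-suc (toℕ i) k) i+k≡j))

    exits-absurd : (∀ {x} → Done x → Live x → ∃ (Exit x)) → ∃ Core → ⊥
    exits-absurd exits (x , core) with done? x
    ... | no ¬d = Walking.no-pending exits (x , core , ¬d)
    ... | yes d with e , ex@(_ , j , _) ← exits d (proj₁ core) =
      Walking.no-pending exits (head e , (joining-live j , joining≢• j) , exit-undone {e = e} ex)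

    some-core : ∃ Core
    some-core with any? core?
    ... | yes witness = witness
    ... | no none = ⊥-elim (no-core-absurd Leftmost.switching (λ n c → none (n , c)))

    one-class : ∃ λ x → Done x × (∀ y → Core y → class x ∋ y)
    one-class with any? (λ x → done? x ×-dec all? (λ y → core? y →-dec (class x ∋? y)))
    ... | yes witness = witness
    ... | no none = ⊥-elim (exits-absurd exits some-core)
      where
      exits : ∀ {x} → Done x → Live x → ∃ (Exit x)
      exits {x} d live with any? (λ y → core? y ×-dec ¬? (class x ∋? y))
      ... | yes (y , core , ∌y) = exit d live core ∌y
      ... | no none-left = contradiction (x , d , all-in) none
        where
        all-in : ∀ y → Core y → class x ∋ y
        all-in y core with class x ∋? y
        ... | yes ∋y = ∋y
        ... | no ∌y = contradiction (y , core , ∌y) none-left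

  -- Only the last rule of a derivation mentions its subset, and only through membership, so the
  -- subderivations are kept.
  Seq-resp : ∀ {S T} → S ⊆ T → T ⊆ S → Seq S → Seq T
  Seq-resp to from (leaf n lab ∋n unique) = leaf n lab (to ∋n) (unique ∘ from)
  Seq-resp to from (step n S lab prem s A) = step n S lab prem s record
    { fresh = Adds.fresh A ; added = to (Adds.added A) ; mono = to ∘ Adds.mono A ; only = Adds.only A ∘ from }
  Seq-resp to from (join n p q S₁ S₂ lab hp hq p≢q ∋p ∋q disj s₁ s₂ A) =
    join n p q S₁ S₂ lab hp hq p≢q ∋p ∋q disj s₁ s₂ record
      { fresh = Adds.fresh A ; added = to (Adds.added A) ; mono = to ∘ Adds.mono A ; only = Adds.only A ∘ from }

  erasing-conclusion : ∀ {v} → Erasing R v → label v ≢ • → ∃ λ a → tail a ≡ v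
  erasing-conclusion (erasing (inj₁ e) _) _ = conclusion e bot-single
  erasing-conclusion (erasing (inj₂ (inj₁ e)) _) _ = conclusion e ⅋-single
  erasing-conclusion (erasing (inj₂ (inj₂ e)) _) ≢• = contradiction e ≢•

  -- Contraction takes in erasing nodes only above a ⅋ that it processes; others, such as a ⊥
  -- pointing to a •, are still outside every class. They are put into the final set by weakening.
  absorb : ∀ {S} → Seq S → ∀ vs → Σ[ T ∈ Subset ] Seq T × S ⊆ T ×
           (∀ {v} → v ∈ vs → Erasing R v → label v ≢ • → T ∋ v)
  absorb {S} s [] = S , s , id , λ ()
  absorb s (v ∷ vs) with T , sT , S⊆T , absorbed ← absorb s vs with erasing? v | •? (label v)
  ... | no ¬e | _ = T , sT , S⊆T , λ { (here refl) e _ → contradiction e ¬e ; (there v∈) → absorbed v∈ }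
  ... | yes _ | yes e• = T , sT , S⊆T , λ { (here refl) _ ≢• → contradiction e• ≢• ; (there v∈) → absorbed v∈ }
  -- `enlarge-arc` adds the tail of an arc, so v is presented as the tail of its conclusion.
  ... | yes e | no ≢• with a , refl ← erasing-conclusion e ≢• with E , ∋v ← enlarge-arc a refl e sT =
    set , seq , mono ∘ S⊆T , λ { (here refl) _ _ → ∋v ; (there v∈) e′ ≢•′ → mono (absorbed v∈ e′ ≢•′) }
    where open Enlargement E

  seq-nonBullet : Seq nonBullet
  seq-nonBullet with st , stuck ← stuck-state with x , d , cores ← one-class st stuck
    with T , sT , ⊆T , absorbed ← absorb (State.seq st d) (allFin #nodes) =
    Seq-resp (λ ∋x → nonBullet-in (noBullet sT _ ∋x)) everything sT
    where
    everything : nonBullet ⊆ T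
    everything {v} ∋v with erasing? v
    ... | yes e = absorbed (∈-allFin v) e (nonBullet-out ∋v)
    ... | no live = ⊆T (cores v (live , nonBullet-out ∋v))

theorem47 : (R : ProofStructure) → [¬w⊗] R → ACC♯w R → Sequential R
theorem47 R ok acc♯w = Sequents.sequential R (Sequentialization.seq-nonBullet R ok acc♯w) R (Sequents.restricts-R R)
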